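{- Let $n\geq 7$ and let $G$ be an edge-colored $K^{(3)}_n$ containing no rainbow copy of $\mathcal{L}$, with $|C(G)|\geq 3$. Then, after renumbering the colors if necessary, at least one of the following holds: (i) there exist two vertices $u,v$ such that every edge $e$ with $c(e)\neq 1$ satisfies $\{u,v\}\subseteq e$; (ii) $|C(G)|\in\{3,4,5\}$, and there exist a vertex $v$ and at most one edge $e\in E(G-v)$ such that all edges of $E(G-v)\setminus\{e\}$ have the same color; (iii) $|C(G)|=3$, and there exists an edge $e$ with $c(e)\neq 1$ such that every edge $f\in E(G)\setminus\{e\}$ with $c(f)\neq 1$ satisfies $|e\cap f|=2$.
   Context: An edge-coloring is any map $c$ from edges to colors; $C(G)$ is the set of colors used; a copy is rainbow if its edges have pairwise distinct colors. $K^{(3)}_n$ is the complete 3-uniform hypergraph on $n$ vertices; $G-v$ is the subhypergraph induced on $V(G)\setminus\{v\}$. The loose path $\mathcal{L}$ has edges $\{v_1v_2v_3,v_3v_4v_5,v_5v_6v_7\}$. -}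

module Defs where

open import Data.Nat using (ℕ; _≟_)
open import Data.Fin using (Fin; _<_; _<?_)
open import Data.Fin.Properties using () renaming (_≟_ to _≟ᶠ_)
open import Data.List using (List; []; _∷_; concatMap; map; length; deduplicate)
open import Data.List.Membership.Propositional using (_∈_)
open import Data.Product using (Σ; _×_; _,_; ∃; ∃-syntax)
open import Data.Sum using (_⊎_)
open import Data.Maybe using (Maybe; just)
open import Relation.Nullary using (¬_; yes; no)
open import Relation.Binary.PropositionalEquality using (_≡_; _≢_)
open import Function.Bundles using (_⇔_)

-- An edge of K^(3)_n: a 3-subset {x,y,z} of Fin n, stored in increasing order
-- (so that each 3-set has exactly one representation).
record Edge (n : ℕ) : Set where
  constructor edge
  field
    x y z : Fin n
    x<y : x < y
    y<z : y < z
open Edge public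

_∈ₑ_ : ∀ {n} → Fin n → Edge n → Set
w ∈ₑ e = (w ≡ x e) ⊎ (w ≡ y e) ⊎ (w ≡ z e)

HasVerts : ∀ {n} → Edge n → Fin n → Fin n → Fin n → Set
HasVerts e a b c = ∀ w → (w ∈ₑ e) ⇔ ((w ≡ a) ⊎ (w ≡ b) ⊎ (w ≡ c))

Colouring : ℕ → Set
Colouring n = Edge n → ℕ

allFinL : (n : ℕ) → List (Fin n)
allFinL n = Data.List.allFin n

mkEdge : ∀ {n} → Fin n → Fin n → Fin n → List (Edge n)
mkEdge a b c with a <? b | b <? c
... | yes p | yes q = edge a b c p q ∷ []
... | _     | _     = []

allEdges : (n : ℕ) → List (Edge n)
allEdges n = concatMap (λ a → concatMap (λ b → concatMap (λ c → mkEdge a b c)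
               (allFinL n)) (allFinL n)) (allFinL n)

numColours : ∀ {n} → Colouring n → ℕ
numColours {n} col = length (deduplicate _≟_ (map col (allEdges n)))

Used : ∀ {n} → Colouring n → ℕ → Set
Used col α = ∃[ e ] col e ≡ α

Distinct7 : ∀ {n} → Fin n → Fin n → Fin n → Fin n → Fin n → Fin n → Fin n → Set
Distinct7 v1 v2 v3 v4 v5 v6 v7 =
  (v1 ≢ v2) × (v1 ≢ v3) × (v1 ≢ v4) × (v1 ≢ v5) × (v1 ≢ v6) × (v1 ≢ v7) ×
  (v2 ≢ v3) × (v2 ≢ v4) × (v2 ≢ v5) × (v2 ≢ v6) × (v2 ≢ v7) ×
  (v3 ≢ v4) × (v3 ≢ v5) × (v3 ≢ v6) × (v3 ≢ v7) ×
  (v4 ≢ v5) × (v4 ≢ v6) × (v4 ≢ v7) ×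
  (v5 ≢ v6) × (v5 ≢ v7) ×
  (v6 ≢ v7)

RainbowLoosePath : ∀ {n} → Colouring n → Set
RainbowLoosePath {n} col =
  Σ (Fin n) λ v1 → Σ (Fin n) λ v2 → Σ (Fin n) λ v3 → Σ (Fin n) λ v4 →
  Σ (Fin n) λ v5 → Σ (Fin n) λ v6 → Σ (Fin n) λ v7 →
  Distinct7 v1 v2 v3 v4 v5 v6 v7 ×
  Σ (Edge n) λ e1 → Σ (Edge n) λ e2 → Σ (Edge n) λ e3 →
  HasVerts e1 v1 v2 v3 × HasVerts e2 v3 v4 v5 × HasVerts e3 v5 v6 v7 ×
  (col e1 ≢ col e2) × (col e1 ≢ col e3) × (col e2 ≢ col e3)

countIn : ∀ {n} → Fin n → Edge n → ℕ
countIn w f with w ≟ᶠ x f | w ≟ᶠ y f | w ≟ᶠ z f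
... | no _ | no _ | no _ = 0
... | _    | _    | _    = 1

interSize : ∀ {n} → Edge n → Edge n → ℕ
interSize e f = Data.Nat._+_ (countIn (x e) f) (Data.Nat._+_ (countIn (y e) f) (countIn (z e) f))

CaseI : ∀ {n} → Colouring n → ℕ → Set
CaseI {n} col α = Σ (Fin n) λ u → Σ (Fin n) λ v → (u ≢ v) ×
  (∀ e → col e ≢ α → (u ∈ₑ e) × (v ∈ₑ e))

CaseII : ∀ {n} → Colouring n → Set
CaseII {n} col =
  ((numColours col ≡ 3) ⊎ (numColours col ≡ 4) ⊎ (numColours col ≡ 5)) ×
  (Σ (Fin n) λ v → Σ (Maybe (Edge n)) λ me → Σ ℕ λ κ →
     -- me = nothing : no exceptional edge; me = just e : e is the (at most one) exception
     ∀ f → ¬ (v ∈ₑ f) → (me ≡ just f) ⊎ (col f ≡ κ))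

CaseIII : ∀ {n} → Colouring n → ℕ → Set
CaseIII {n} col α = (numColours col ≡ 3) ×
  (Σ (Edge n) λ e → (col e ≢ α) ×
     (∀ f → f ≢ e → col f ≢ α → interSize e f ≡ 2))

{-# OPTIONS --safe #-}
module Submission where

-- Two triples uva, uvb of different colours and a triple of a third colour span at most
-- seven vertices, so following loose paths through them produces uva, uvb, xyu in three
-- different colours, with six distinct vertices.  Write α for the colour of xyu.  Further
-- loose paths show that α is the colour of every triple except possibly those of the forms
-- uva, uvb, uab, vab, xuv, xua, xub, xva, xvb with x outside {u, v, a, b}, and that two
-- exceptional triples of different colours cannot meet in a single vertex or be disjoint.
-- The three cases are then read off from which of the families xua, xub, xva, xvb contain
-- a triple of colour other than α.

open import Defs
open import Data.Nat using (ℕ; suc; _+_; _<ᵇ_; _≤_; _≥_; z≤n; s≤s)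
open import Data.Product using (Σ; _×_; _,_; ∃; proj₁; proj₂)
open import Data.Sum using (_⊎_; swap; inj₁; inj₂; [_,_]′)
open import Relation.Nullary using (¬_; Dec; yes; no; contradiction; ¬?)
import Data.Nat.Properties as ℕₚ
open import Data.Nat.Properties using () renaming (_≟_ to _≟ⁿ_)
open import Data.Fin using (Fin; toℕ; _<_) renaming (_≤_ to _≤ᶠ_)
open import Data.Fin.Patterns using (0F; 1F; 2F; 3F; 4F; 5F; 6F)
import Data.Fin.Properties as Finₚ
open import Data.Fin.Properties using (any?) renaming (_≟_ to _≟ᶠ_)
open import Data.List using (List; []; _∷_; map; length; lookup)
open import Data.List.Membership.Propositional using (_∈_)
open import Data.List.Membership.Propositional.Properties
  using (∈-map⁻; ∈-deduplicate⁻; ∈-lookup)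
open import Data.List.Relation.Unary.Any as Any using (Any; here; there)
open import Data.List.Relation.Unary.Any.Properties using (lookup-index)
open import Data.List.Relation.Unary.All as All using (All; []; _∷_)
open import Data.List.Relation.Unary.All.Properties using (¬Any⇒All¬)
open import Data.List.Relation.Unary.AllPairs using ([]; _∷_)
open import Data.List.Relation.Unary.Unique.Propositional using (Unique)
import Data.List.Relation.Unary.Unique.Propositional.Properties as Uniqueₚ
import Data.List.Relation.Unary.Unique.DecPropositional as DecUnique
open import Data.List.Relation.Unary.Unique.DecPropositional.Properties using (deduplicate-!)
open import Data.Bool using (true; false; if_then_else_)
open import Data.Maybe using (just)
open import Data.Empty using (⊥; ⊥-elim)
open import Function using (_∘_; id)
open import Function.Bundles using (mk⇔; Equivalence)
open import Function.Definitions using (Injective)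
open import Relation.Binary.Definitions using (tri<; tri≈; tri>)
open import Relation.Binary.PropositionalEquality
  using (_≡_; _≢_; refl; sym; trans; cong; cong₂; subst; ≢-sym)
open import Relation.Nullary.Decidable using (True; decidable-stable; toWitness; _⊎-dec_; _×-dec_)

open DecUnique {A = Fin 7} _≟ᶠ_ using (unique?)

-- Most colours are forced by pairs of paths that differ by swapping a and b: one path confines a
-- triple to α or the colour of uva, the other to α or the colour of uvb, and as these two colours
-- differ, only α remains. This needs a triple that the swap fixes. The triples xua and xub are
-- swapped with each other and keep a second possible colour, that of uvb for xua and that of uva
-- for xub; likewise xva and xvb. The triples xuv, uab and vab are not confined in this way: the
-- bound of five colours in (ii) arises as α, the colours of uva and uvb, and at most two further
-- colours from these triples. An obstacle comes before this: the third colour may sit on a triple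
-- in any position relative to u, v, a, b. The configuration xyu, uva, uvb that is sought need not
-- keep the given u, v, a, b; in several positions their roles are reassigned.

lookup-injective : ∀ {A : Set} {xs : List A} → Unique xs → Injective _≡_ _≡_ (lookup xs)
lookup-injective (_  ∷ _)  {Fin.zero}  {Fin.zero}  _  = refl
lookup-injective (p ∷ _)   {Fin.zero}  {Fin.suc j} eq = contradiction eq (All.lookup p (∈-lookup j))
lookup-injective (p ∷ _)   {Fin.suc i} {Fin.zero}  eq = contradiction (sym eq) (All.lookup p (∈-lookup i))
lookup-injective (_  ∷ ps) {Fin.suc i} {Fin.suc j} eq = cong Fin.suc (lookup-injective ps eq)

unique-⊆⇒length≤ : ∀ {A : Set} {xs ys : List A} → Unique xs →
  (∀ {w} → w ∈ xs → w ∈ ys) → length xs ≤ length ys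
unique-⊆⇒length≤ {xs = xs} {ys} xs! xs⊆ys = Finₚ.injective⇒≤ {f = position} position-injective
  where
  position : Fin (length xs) → Fin (length ys)
  position i = Any.index (xs⊆ys (∈-lookup {xs = xs} i))
  position-injective : Injective _≡_ _≡_ position
  position-injective {i} {j} eq = lookup-injective xs!
    (trans (lookup-index (xs⊆ys (∈-lookup {xs = xs} i)))
      (trans (cong (lookup ys) eq) (sym (lookup-index (xs⊆ys (∈-lookup {xs = xs} j))))))

fresh : ∀ {n} (L : List (Fin n)) → length L Data.Nat.< n → ∃ λ w → All (w ≢_) L
fresh {n} L short with any? (λ w → All.all? (λ t → ¬? (w ≟ᶠ t)) L)
... | yes found = found
... | no none = contradiction (Finₚ.injective⇒≤ {f = position} position-injective) (ℕₚ.<⇒≱ short)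
  where
  ∈L : ∀ w → w ∈ L
  ∈L w with Any.any? (w ≟ᶠ_) L
  ... | yes w∈L = w∈L
  ... | no w∉L = contradiction (w , ¬Any⇒All¬ L w∉L) none
  position : Fin n → Fin (length L)
  position w = Any.index (∈L w)
  position-injective : Injective _≡_ _≡_ position
  position-injective {i} {j} eq = trans (lookup-index (∈L i))
    (trans (cong (lookup L) eq) (sym (lookup-index (∈L j))))

-- Edges as unordered triples

record Spans {n} (e : Edge n) (p q r : Fin n) : Set where
  constructor spans
  field
    verts : HasVerts e p q r
    p≢q : p ≢ q
    p≢r : p ≢ r
    q≢r : q ≢ r
open Spans

module _ {n : ℕ} where

  _∈ₑ?_ : (w : Fin n) (e : Edge n) → Dec (w ∈ₑ e)
  w ∈ₑ? e = (w ≟ᶠ x e) ⊎-dec ((w ≟ᶠ y e) ⊎-dec (w ≟ᶠ z e))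

  swap₁₂ : ∀ {e : Edge n} {p q r} → Spans e p q r → Spans e q p r
  swap₁₂ {e} {p} {q} {r} (spans h pq pr qr) = spans
    (λ w → mk⇔ (exch ∘ Equivalence.to (h w)) (Equivalence.from (h w) ∘ exch)) (≢-sym pq) qr pr
    where
    exch : ∀ {A B C : Set} → A ⊎ B ⊎ C → B ⊎ A ⊎ C
    exch (inj₁ t) = inj₂ (inj₁ t)
    exch (inj₂ (inj₁ t)) = inj₁ t
    exch (inj₂ (inj₂ t)) = inj₂ (inj₂ t)

  swap₂₃ : ∀ {e : Edge n} {p q r} → Spans e p q r → Spans e p r q
  swap₂₃ {e} {p} {q} {r} (spans h pq pr qr) = spans
    (λ w → mk⇔ (exch ∘ Equivalence.to (h w)) (Equivalence.from (h w) ∘ exch)) pr pq (≢-sym qr)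
    where
    exch : ∀ {A B C : Set} → A ⊎ B ⊎ C → A ⊎ C ⊎ B
    exch (inj₁ t) = inj₁ t
    exch (inj₂ (inj₁ t)) = inj₂ (inj₂ t)
    exch (inj₂ (inj₂ t)) = inj₂ (inj₁ t)

  first∈ : ∀ {e : Edge n} {p q r} → Spans e p q r → p ∈ₑ e
  first∈ s = Equivalence.from (verts s _) (inj₁ refl)

  second∈ : ∀ {e : Edge n} {p q r} → Spans e p q r → q ∈ₑ e
  second∈ = first∈ ∘ swap₁₂

  third∈ : ∀ {e : Edge n} {p q r} → Spans e p q r → r ∈ₑ e
  third∈ = second∈ ∘ swap₂₃

  spans-self : (e : Edge n) → Spans e (x e) (y e) (z e)
  spans-self e = spans (λ _ → mk⇔ id id) (Finₚ.<⇒≢ (x<y e))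
    (Finₚ.<⇒≢ (Finₚ.<-trans (x<y e) (y<z e))) (Finₚ.<⇒≢ (y<z e))

  private
    spanning-sorted : ∀ {p q r : Fin n} → p < q → p ≢ r → q ≢ r → ∃ λ e → Spans e p q r
    spanning-sorted {p} {q} {r} p<q pr qr with Finₚ.<-cmp q r
    ... | tri≈ _ q≡r _ = contradiction q≡r qr
    ... | tri< q<r _ _ = edge p q r p<q q<r , spans-self _
    ... | tri> _ _ r<q with Finₚ.<-cmp p r
    ... | tri≈ _ p≡r _ = contradiction p≡r pr
    ... | tri< p<r _ _ = edge p r q p<r r<q , swap₂₃ (spans-self _)
    ... | tri> _ _ r<p = edge r p q r<p p<q , swap₂₃ (swap₁₂ (spans-self _))

  spanning : ∀ {p q r : Fin n} → p ≢ q → p ≢ r → q ≢ r → ∃ λ e → Spans e p q r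
  spanning {p} {q} pq pr qr with Finₚ.<-cmp p q
  ... | tri≈ _ p≡q _ = contradiction p≡q pq
  ... | tri< p<q _ _ = spanning-sorted p<q pr qr
  ... | tri> _ _ q<p = let e , s = spanning-sorted q<p qr pr in e , swap₁₂ s

  x-least : (e : Edge n) {w : Fin n} → w ∈ₑ e → x e ≤ᶠ w
  x-least e (inj₁ refl) = Finₚ.≤-refl
  x-least e (inj₂ (inj₁ refl)) = ℕₚ.<⇒≤ (x<y e)
  x-least e (inj₂ (inj₂ refl)) = ℕₚ.<⇒≤ (Finₚ.<-trans (x<y e) (y<z e))

  z-greatest : (e : Edge n) {w : Fin n} → w ∈ₑ e → w ≤ᶠ z e
  z-greatest e (inj₁ refl) = ℕₚ.<⇒≤ (Finₚ.<-trans (x<y e) (y<z e))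
  z-greatest e (inj₂ (inj₁ refl)) = ℕₚ.<⇒≤ (y<z e)
  z-greatest e (inj₂ (inj₂ refl)) = Finₚ.≤-refl

  -- Edges are stored sorted, so `x` and `z` are the minimum and maximum of the vertex set and agree
  -- at once; `y` is then the only vertex left.
  edge-ext : {e f : Edge n} → (∀ w → w ∈ₑ e → w ∈ₑ f) → (∀ w → w ∈ₑ f → w ∈ₑ e) → e ≡ f
  edge-ext {e} {f} e⊆f f⊆e = build
    (Finₚ.≤-antisym (x-least e (f⊆e _ (inj₁ refl))) (x-least f (e⊆f _ (inj₁ refl))))
    (e⊆f _ (inj₂ (inj₁ refl)))
    (Finₚ.≤-antisym (z-greatest f (e⊆f _ (inj₂ (inj₂ refl)))) (z-greatest e (f⊆e _ (inj₂ (inj₂ refl)))))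
    where
    build : x e ≡ x f → y e ∈ₑ f → z e ≡ z f → e ≡ f
    build xx (inj₁ yx) _ = contradiction (trans xx (sym yx)) (Finₚ.<⇒≢ (x<y e))
    build _ (inj₂ (inj₂ yz)) zz = contradiction (trans yz (sym zz)) (Finₚ.<⇒≢ (y<z e))
    build refl (inj₂ (inj₁ refl)) refl =
      cong₂ (edge _ _ _) (Finₚ.<-irrelevant (x<y e) (x<y f)) (Finₚ.<-irrelevant (y<z e) (y<z f))

  spans-unique : ∀ {e f : Edge n} {p q r} → Spans e p q r → Spans f p q r → e ≡ f
  spans-unique s t = edge-ext
    (λ w → Equivalence.from (verts t w) ∘ Equivalence.to (verts s w))
    (λ w → Equivalence.from (verts s w) ∘ Equivalence.to (verts t w))

  spans-through : ∀ {u} (e : Edge n) → u ∈ₑ e → ∃ λ p → ∃ λ q → Spans e u p q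
  spans-through e (inj₁ refl) = _ , _ , spans-self e
  spans-through e (inj₂ (inj₁ refl)) = _ , _ , swap₁₂ (spans-self e)
  spans-through e (inj₂ (inj₂ refl)) = _ , _ , swap₁₂ (swap₂₃ (spans-self e))

  spans-through₂ : ∀ {u v} (e : Edge n) → u ≢ v → u ∈ₑ e → v ∈ₑ e → ∃ λ r → Spans e u v r
  spans-through₂ {v = v} e u≢v u∈e v∈e with spans-through e u∈e
  ... | p , q , s with Equivalence.to (verts s v) v∈e
  ... | inj₁ v≡u = contradiction (sym v≡u) u≢v
  ... | inj₂ (inj₁ refl) = q , s
  ... | inj₂ (inj₂ refl) = p , swap₂₃ s

  countIn-∈ : ∀ {w} (f : Edge n) → w ∈ₑ f → countIn w f ≡ 1
  countIn-∈ {w} f w∈f with w ≟ᶠ x f | w ≟ᶠ y f | w ≟ᶠ z f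
  ... | no nx | no ny | no nz = contradiction w∈f [ nx , [ ny , nz ]′ ]′
  ... | yes _ | yes _ | yes _ = refl
  ... | yes _ | yes _ | no _ = refl
  ... | yes _ | no _ | yes _ = refl
  ... | yes _ | no _ | no _ = refl
  ... | no _ | yes _ | yes _ = refl
  ... | no _ | yes _ | no _ = refl
  ... | no _ | no _ | yes _ = refl

  countIn-∉ : ∀ {w} (f : Edge n) → ¬ w ∈ₑ f → countIn w f ≡ 0
  countIn-∉ {w} f w∉f with w ≟ᶠ x f | w ≟ᶠ y f | w ≟ᶠ z f
  ... | no _ | no _ | no _ = refl
  ... | yes e | _ | _ = contradiction (inj₁ e) w∉f
  ... | no _ | yes e | _ = contradiction (inj₂ (inj₁ e)) w∉f
  ... | no _ | no _ | yes e = contradiction (inj₂ (inj₂ e)) w∉f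

  -- `interSize` adds the counts in the sorted order of `e`, so the split is on the slot that holds
  -- `r`: that slot counts 0 and the other two count 1.
  interSize-two : ∀ {e f : Edge n} {p q r s} → Spans e p q r → Spans f p q s → r ≢ s →
    interSize e f ≡ 2
  interSize-two {e} {f} {p} {q} {r} {s} e≈ f≈ r≢s = sum (third∈ e≈)
    where
    r∉f : ¬ r ∈ₑ f
    r∉f r∈f with Equivalence.to (verts f≈ r) r∈f
    ... | inj₁ r≡p = p≢r e≈ (sym r≡p)
    ... | inj₂ (inj₁ r≡q) = q≢r e≈ (sym r≡q)
    ... | inj₂ (inj₂ r≡s) = r≢s r≡s
    one : ∀ {w} → w ∈ₑ e → w ≢ r → countIn w f ≡ 1
    one {w} w∈e w≢r with Equivalence.to (verts e≈ w) w∈e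
    ... | inj₁ refl = countIn-∈ f (first∈ f≈)
    ... | inj₂ (inj₁ refl) = countIn-∈ f (second∈ f≈)
    ... | inj₂ (inj₂ w≡r) = contradiction w≡r w≢r
    xe≢ye : x e ≢ y e
    xe≢ye = p≢q (spans-self e)
    xe≢ze : x e ≢ z e
    xe≢ze = p≢r (spans-self e)
    ye≢ze : y e ≢ z e
    ye≢ze = q≢r (spans-self e)
    add : ∀ {i j k i′ j′ k′} → i ≡ i′ → j ≡ j′ → k ≡ k′ → i + (j + k) ≡ i′ + (j′ + k′)
    add refl refl refl = refl
    sum : r ∈ₑ e → interSize e f ≡ 2
    sum (inj₁ refl) = add (countIn-∉ f r∉f)
      (one (inj₂ (inj₁ refl)) (≢-sym xe≢ye)) (one (inj₂ (inj₂ refl)) (≢-sym xe≢ze))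
    sum (inj₂ (inj₁ refl)) = add (one (inj₁ refl) xe≢ye) (countIn-∉ f r∉f)
      (one (inj₂ (inj₂ refl)) (≢-sym ye≢ze))
    sum (inj₂ (inj₂ refl)) = add (one (inj₁ refl) xe≢ze)
      (one (inj₂ (inj₁ refl)) ye≢ze) (countIn-∉ f r∉f)

-- The position of an edge relative to four vertices

Outside : ∀ {n} → Fin n → Fin n → Fin n → Fin n → Fin n → Set
Outside u v a b w = All (w ≢_) (u ∷ v ∷ a ∷ b ∷ [])

data Shape {n} (u v a b : Fin n) (e : Edge n) : Set where
  uva : Spans e u v a → Shape u v a b e
  uvb : Spans e u v b → Shape u v a b e
  uab : Spans e u a b → Shape u v a b e
  vab : Spans e v a b → Shape u v a b e
  xuv : ∀ {x} → Outside u v a b x → Spans e x u v → Shape u v a b e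
  xua : ∀ {x} → Outside u v a b x → Spans e x u a → Shape u v a b e
  xub : ∀ {x} → Outside u v a b x → Spans e x u b → Shape u v a b e
  xva : ∀ {x} → Outside u v a b x → Spans e x v a → Shape u v a b e
  xvb : ∀ {x} → Outside u v a b x → Spans e x v b → Shape u v a b e
  xab : ∀ {x} → Outside u v a b x → Spans e x a b → Shape u v a b e
  xyu : ∀ {x y} → Outside u v a b x → Outside u v a b y → Spans e x y u → Shape u v a b e
  xyv : ∀ {x y} → Outside u v a b x → Outside u v a b y → Spans e x y v → Shape u v a b e
  xya : ∀ {x y} → Outside u v a b x → Outside u v a b y → Spans e x y a → Shape u v a b e
  xyb : ∀ {x y} → Outside u v a b x → Outside u v a b y → Spans e x y b → Shape u v a b e
  xyz : ∀ {x y z} → Outside u v a b x → Outside u v a b y → Outside u v a b z →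
    Spans e x y z → Shape u v a b e

module _ {n} {u v a b : Fin n} where

  unique-uv : Unique (u ∷ v ∷ a ∷ b ∷ []) → Unique (v ∷ u ∷ a ∷ b ∷ [])
  unique-uv ((uv ∷ ua ∷ ub ∷ []) ∷ (va ∷ vb ∷ []) ∷ ab!) =
    (≢-sym uv ∷ va ∷ vb ∷ []) ∷ (ua ∷ ub ∷ []) ∷ ab!

  unique-ab : Unique (u ∷ v ∷ a ∷ b ∷ []) → Unique (u ∷ v ∷ b ∷ a ∷ [])
  unique-ab ((uv ∷ ua ∷ ub ∷ []) ∷ (va ∷ vb ∷ []) ∷ (ab ∷ []) ∷ [] ∷ []) =
    (uv ∷ ub ∷ ua ∷ []) ∷ (vb ∷ va ∷ []) ∷ (≢-sym ab ∷ []) ∷ [] ∷ []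

  outside-uv : ∀ {w} → Outside u v a b w → Outside v u a b w
  outside-uv (wu ∷ wv ∷ w∉ab) = wv ∷ wu ∷ w∉ab

  outside-ab : ∀ {w} → Outside u v a b w → Outside u v b a w
  outside-ab (wu ∷ wv ∷ wa ∷ wb ∷ []) = wu ∷ wv ∷ wb ∷ wa ∷ []

apart : ∀ {n} (e : Edge n) {u w} → ¬ u ∈ₑ e → w ∈ₑ e → w ≢ u
apart _ u∉e w∈e refl = u∉e w∈e

shape : ∀ {n} {u v a b : Fin n} → Unique (u ∷ v ∷ a ∷ b ∷ []) → (e : Edge n) → Shape u v a b e
shape {u = u} {v} {a} {b} ((u≢v ∷ u≢a ∷ u≢b ∷ []) ∷ (v≢a ∷ v≢b ∷ []) ∷ (a≢b ∷ []) ∷ [] ∷ []) e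
  with u ∈ₑ? e | v ∈ₑ? e | a ∈ₑ? e | b ∈ₑ? e
... | yes u∈ | yes v∈ | _ | _ = third (spans-through₂ e u≢v u∈ v∈)
  where
  third : (∃ λ r → Spans e u v r) → Shape u v a b e
  third (r , s) with r ≟ᶠ a | r ≟ᶠ b
  ... | yes refl | _ = uva s
  ... | no _ | yes refl = uvb s
  ... | no r≢a | no r≢b = xuv (≢-sym (p≢r s) ∷ ≢-sym (q≢r s) ∷ r≢a ∷ r≢b ∷ []) (swap₁₂ (swap₂₃ s))
... | yes u∈ | no v∉ | yes a∈ | _ = third (spans-through₂ e u≢a u∈ a∈)
  where
  third : (∃ λ r → Spans e u a r) → Shape u v a b e
  third (r , s) with r ≟ᶠ b
  ... | yes refl = uab s
  ... | no r≢b = xua (≢-sym (p≢r s) ∷ apart e v∉ (third∈ s) ∷ ≢-sym (q≢r s) ∷ r≢b ∷ []) (swap₁₂ (swap₂₃ s))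
... | yes u∈ | no v∉ | no a∉ | yes b∈ =
  let r , s = spans-through₂ e u≢b u∈ b∈ in
  xub (≢-sym (p≢r s) ∷ apart e v∉ (third∈ s) ∷ apart e a∉ (third∈ s) ∷ ≢-sym (q≢r s) ∷ [])
    (swap₁₂ (swap₂₃ s))
... | yes u∈ | no v∉ | no a∉ | no b∉ =
  let p , q , s = spans-through e u∈ in
  xyu (≢-sym (p≢q s) ∷ apart e v∉ (second∈ s) ∷ apart e a∉ (second∈ s) ∷ apart e b∉ (second∈ s) ∷ [])
    (≢-sym (p≢r s) ∷ apart e v∉ (third∈ s) ∷ apart e a∉ (third∈ s) ∷ apart e b∉ (third∈ s) ∷ [])
    (swap₂₃ (swap₁₂ s))
... | no u∉ | yes v∈ | yes a∈ | _ = third (spans-through₂ e v≢a v∈ a∈)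
  where
  third : (∃ λ r → Spans e v a r) → Shape u v a b e
  third (r , s) with r ≟ᶠ b
  ... | yes refl = vab s
  ... | no r≢b = xva (apart e u∉ (third∈ s) ∷ ≢-sym (p≢r s) ∷ ≢-sym (q≢r s) ∷ r≢b ∷ []) (swap₁₂ (swap₂₃ s))
... | no u∉ | yes v∈ | no a∉ | yes b∈ =
  let r , s = spans-through₂ e v≢b v∈ b∈ in
  xvb (apart e u∉ (third∈ s) ∷ ≢-sym (p≢r s) ∷ apart e a∉ (third∈ s) ∷ ≢-sym (q≢r s) ∷ [])
    (swap₁₂ (swap₂₃ s))
... | no u∉ | yes v∈ | no a∉ | no b∉ =
  let p , q , s = spans-through e v∈ in
  xyv (apart e u∉ (second∈ s) ∷ ≢-sym (p≢q s) ∷ apart e a∉ (second∈ s) ∷ apart e b∉ (second∈ s) ∷ [])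
    (apart e u∉ (third∈ s) ∷ ≢-sym (p≢r s) ∷ apart e a∉ (third∈ s) ∷ apart e b∉ (third∈ s) ∷ [])
    (swap₂₃ (swap₁₂ s))
... | no u∉ | no v∉ | yes a∈ | yes b∈ =
  let r , s = spans-through₂ e a≢b a∈ b∈ in
  xab (apart e u∉ (third∈ s) ∷ apart e v∉ (third∈ s) ∷ ≢-sym (p≢r s) ∷ ≢-sym (q≢r s) ∷ [])
    (swap₁₂ (swap₂₃ s))
... | no u∉ | no v∉ | yes a∈ | no b∉ =
  let p , q , s = spans-through e a∈ in
  xya (apart e u∉ (second∈ s) ∷ apart e v∉ (second∈ s) ∷ ≢-sym (p≢q s) ∷ apart e b∉ (second∈ s) ∷ [])
    (apart e u∉ (third∈ s) ∷ apart e v∉ (third∈ s) ∷ ≢-sym (p≢r s) ∷ apart e b∉ (third∈ s) ∷ [])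
    (swap₂₃ (swap₁₂ s))
... | no u∉ | no v∉ | no a∉ | yes b∈ =
  let p , q , s = spans-through e b∈ in
  xyb (apart e u∉ (second∈ s) ∷ apart e v∉ (second∈ s) ∷ apart e a∉ (second∈ s) ∷ ≢-sym (p≢q s) ∷ [])
    (apart e u∉ (third∈ s) ∷ apart e v∉ (third∈ s) ∷ apart e a∉ (third∈ s) ∷ ≢-sym (p≢r s) ∷ [])
    (swap₂₃ (swap₁₂ s))
... | no u∉ | no v∉ | no a∉ | no b∉ = xyz (out (inj₁ refl)) (out (inj₂ (inj₁ refl))) (out (inj₂ (inj₂ refl))) (spans-self e)
  where
  out : ∀ {w} → w ∈ₑ e → Outside u v a b w
  out w∈ = apart e u∉ w∈ ∷ apart e v∉ w∈
    ∷ apart e a∉ w∈ ∷ apart e b∉ w∈ ∷ []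

-- Restrictions on colours

common : ∀ {κ α β γ : ℕ} → β ≢ γ → κ ≡ α ⊎ κ ≡ β → κ ≡ α ⊎ κ ≡ γ → κ ≡ α
common _ (inj₁ p) _ = p
common _ (inj₂ _) (inj₁ q) = q
common β≢γ (inj₂ p) (inj₂ q) = contradiction (trans (sym p) q) β≢γ

-- This is all that a loose path whose third triple has colour α says about its other two triples:
-- they cannot deviate from α in two different colours.
Compatible : ℕ → ℕ → ℕ → Set
Compatible α κ μ = κ ≡ α ⊎ μ ≡ α ⊎ κ ≡ μ

compatible : ∀ {α κ μ ν} → ν ≡ α → (κ ≢ μ → ν ≡ κ ⊎ ν ≡ μ) → Compatible α κ μ
compatible {κ = κ} {μ} refl h with κ ≟ⁿ μ
... | yes κ≡μ = inj₂ (inj₂ κ≡μ)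
... | no κ≢μ with h κ≢μ
... | inj₁ p = inj₁ (sym p)
... | inj₂ q = inj₂ (inj₁ (sym q))

-- A deviating triple passes its own confinement on to every triple compatible with it. `resist` is
-- the reverse use: a colour outside the confinement forces its partner back to α.
follow : ∀ {α γ κ μ} → Compatible α κ μ → μ ≢ α → μ ≡ α ⊎ μ ≡ γ → κ ≡ α ⊎ κ ≡ γ
follow (inj₁ κ≡α) _ _ = inj₁ κ≡α
follow (inj₂ (inj₁ μ≡α)) μ≢α _ = contradiction μ≡α μ≢α
follow (inj₂ (inj₂ refl)) _ μ∈αγ = μ∈αγ

resist : ∀ {α γ κ μ} → Compatible α κ μ → ¬ (κ ≡ α ⊎ κ ≡ γ) → μ ≡ α ⊎ μ ≡ γ → μ ≡ α
resist (inj₁ κ≡α) κ∉αγ _ = contradiction (inj₁ κ≡α) κ∉αγ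
resist (inj₂ (inj₁ μ≡α)) _ _ = μ≡α
resist (inj₂ (inj₂ refl)) κ∉αγ μ∈αγ = contradiction μ∈αγ κ∉αγ

-- Loose paths on seven vertices

pattern X = 0F
pattern Y = 1F
pattern Z = 2F
pattern U = 3F
pattern V = 4F
pattern A = 5F
pattern B = 6F

-- Colours of unordered triples

module _ {n : ℕ} (col : Colouring n) where

  distinct? : (p q r : Fin n) → Dec (p ≢ q × p ≢ r × q ≢ r)
  distinct? p q r = ¬? (p ≟ᶠ q) ×-dec (¬? (p ≟ᶠ r) ×-dec ¬? (q ≟ᶠ r))

  abstract
    -- The junk value 0 on degenerate triples keeps c totally symmetric.
    c : Fin n → Fin n → Fin n → ℕ
    c p q r with distinct? p q r
    ... | yes (pq , pr , qr) = col (proj₁ (spanning pq pr qr))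
    ... | no _ = 0

    c-spans : ∀ {e p q r} → Spans e p q r → c p q r ≡ col e
    c-spans {p = p} {q} {r} s with distinct? p q r
    ... | yes (pq , pr , qr) = cong col (spans-unique (proj₂ (spanning pq pr qr)) s)
    ... | no degenerate = contradiction (p≢q s , p≢r s , q≢r s) degenerate

    c-degenerate : ∀ {p q r} → ¬ (p ≢ q × p ≢ r × q ≢ r) → c p q r ≡ 0
    c-degenerate {p} {q} {r} degenerate with distinct? p q r
    ... | yes d = contradiction d degenerate
    ... | no _ = refl

  c₁₂ : ∀ p q r → c p q r ≡ c q p r
  c₁₂ p q r with distinct? p q r
  ... | yes (pq , pr , qr) = let _ , s = spanning pq pr qr in trans (c-spans s) (sym (c-spans (swap₁₂ s)))
  ... | no degenerate = trans (c-degenerate degenerate) (sym (c-degenerate λ (qp , qr , pr) → degenerate (≢-sym qp , pr , qr)))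

  c₂₃ : ∀ p q r → c p q r ≡ c p r q
  c₂₃ p q r with distinct? p q r
  ... | yes (pq , pr , qr) = let _ , s = spanning pq pr qr in trans (c-spans s) (sym (c-spans (swap₂₃ s)))
  ... | no degenerate = trans (c-degenerate degenerate) (sym (c-degenerate λ (pr , pq , rq) → degenerate (pq , pr , ≢-sym rq)))

  -- Triples of different colours sharing two vertices

  record Adjacent : Set where
    constructor adjacent
    field
      {u v a b} : Fin n
      uvab! : Unique (u ∷ v ∷ a ∷ b ∷ [])
      uva≢uvb : c u v a ≢ c u v b

  sharing-two : ∀ {e f p q r s} → Spans e p q r → Spans f p q s → col e ≢ col f → Adjacent
  sharing-two {r = r} {s} e≈ f≈ ne = adjacent
    ((p≢q e≈ ∷ p≢r e≈ ∷ p≢r f≈ ∷ []) ∷ (q≢r e≈ ∷ q≢r f≈ ∷ []) ∷ (r≢s ∷ []) ∷ [] ∷ [])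
    (λ eq → ne (trans (sym (c-spans e≈)) (trans eq (c-spans f≈))))
    where
    r≢s : r ≢ s
    r≢s refl = ne (cong col (spans-unique e≈ f≈))

  -- Replacing the vertices of `e` by those of `f` one at a time, the colour must change at some
  -- replacement, and the two triples before and after it share two vertices. The intermediate
  -- triple is `g`.
  sharing-one : ∀ {e f p q r s t} → Spans e p q r → Spans f p s t → col e ≢ col f → Adjacent
  sharing-one {e} {f} {p} {q} {r} {s} {t} e≈ f≈ ne with s ≟ᶠ q | s ≟ᶠ r
  ... | yes refl | _ = sharing-two e≈ f≈ ne
  ... | no _ | yes refl = sharing-two (swap₂₃ e≈) f≈ ne
  ... | no sq | no _ with spanning (p≢q e≈) (p≢q f≈) (≢-sym sq)
  ... | g , g≈ with col g ≟ⁿ col e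
  ... | no g≢e = sharing-two g≈ e≈ g≢e
  ... | yes g≡e = sharing-two (swap₂₃ g≈) f≈ (λ g≡f → ne (trans (sym g≡e) g≡f))

  colours-differ⇒adjacent : ∀ e f → col e ≢ col f → Adjacent
  colours-differ⇒adjacent e f ne = go (spans-self e) (spans-self f)
    where
    go : ∀ {p q r s t w} → Spans e p q r → Spans f s t w → Adjacent
    go {p} {q} {r} {s} e≈ f≈ with s ≟ᶠ p | s ≟ᶠ q | s ≟ᶠ r
    ... | yes refl | _ | _ = sharing-one e≈ f≈ ne
    ... | no _ | yes refl | _ = sharing-one (swap₁₂ e≈) f≈ ne
    ... | no _ | no _ | yes refl = sharing-one (swap₁₂ (swap₂₃ e≈)) f≈ ne
    ... | no sp | no sq | no _ with spanning (p≢q e≈) (≢-sym sp) (≢-sym sq)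
    ... | g , g≈ with col g ≟ⁿ col e
    ... | no g≢e = sharing-two g≈ e≈ g≢e
    ... | yes g≡e = sharing-one (swap₁₂ (swap₂₃ g≈)) f≈ (λ g≡f → ne (trans (sym g≡e) g≡f))

  -- Edges chosen by colour

  three-colours : 3 ≤ numColours col →
    ∃ λ e₁ → ∃ λ e₂ → ∃ λ e₃ → col e₁ ≢ col e₂ × col e₁ ≢ col e₃ × col e₂ ≢ col e₃
  three-colours = go (deduplicate-! _≟ⁿ_ colours) (∈-map⁻ col ∘ ∈-deduplicate⁻ _≟ⁿ_ colours)
    where
    colours : List ℕ
    colours = map col (allEdges n)
    go : ∀ {L} → Unique L → (∀ {κ} → κ ∈ L → ∃ λ e → e ∈ allEdges n × κ ≡ col e) → 3 ≤ length L →
      ∃ λ e₁ → ∃ λ e₂ → ∃ λ e₃ → col e₁ ≢ col e₂ × col e₁ ≢ col e₃ × col e₂ ≢ col e₃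
    go ((ne₁₂ ∷ ne₁₃ ∷ _) ∷ (ne₂₃ ∷ _) ∷ _) used (s≤s (s≤s (s≤s _)))
      with used (here refl) | used (there (here refl)) | used (there (there (here refl)))
    ... | e₁ , _ , refl | e₂ , _ , refl | e₃ , _ , refl = e₁ , e₂ , e₃ , ne₁₂ , ne₁₃ , ne₂₃

  avoiding-two : 3 ≤ numColours col → ∀ κ μ → ∃ λ e → col e ≢ κ × col e ≢ μ
  avoiding-two 3≤ κ μ with three-colours 3≤
  ... | e₁ , e₂ , e₃ , ne₁₂ , ne₁₃ , ne₂₃ with avoids? e₁ | avoids? e₂ | avoids? e₃
    where
    avoids? : ∀ e → (col e ≢ κ × col e ≢ μ) ⊎ (col e ≡ κ ⊎ col e ≡ μ)
    avoids? e with col e ≟ⁿ κ | col e ≟ⁿ μ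
    ... | yes p | _ = inj₂ (inj₁ p)
    ... | no _ | yes q = inj₂ (inj₂ q)
    ... | no p | no q = inj₁ (p , q)
  ... | inj₁ ok | _ | _ = e₁ , ok
  ... | _ | inj₁ ok | _ = e₂ , ok
  ... | _ | _ | inj₁ ok = e₃ , ok
  ... | inj₂ (inj₁ p) | inj₂ (inj₁ q) | _ = contradiction (trans p (sym q)) ne₁₂
  ... | inj₂ (inj₂ p) | inj₂ (inj₂ q) | _ = contradiction (trans p (sym q)) ne₁₂
  ... | inj₂ (inj₁ p) | _ | inj₂ (inj₁ r) = contradiction (trans p (sym r)) ne₁₃
  ... | inj₂ (inj₂ p) | _ | inj₂ (inj₂ r) = contradiction (trans p (sym r)) ne₁₃
  ... | _ | inj₂ (inj₁ q) | inj₂ (inj₁ r) = contradiction (trans q (sym r)) ne₂₃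
  ... | _ | inj₂ (inj₂ q) | inj₂ (inj₂ r) = contradiction (trans q (sym r)) ne₂₃

  -- The colour of the triple with indices i, j, k, sorted so that for literal
  -- indices all orders of the same triple agree definitionally.
  K : (Fin 7 → Fin n) → Fin 7 → Fin 7 → Fin 7 → ℕ
  K f i j k = if toℕ i <ᵇ toℕ j then insert i j else insert j i
    where
    insert : Fin 7 → Fin 7 → ℕ
    insert i j =
      if toℕ j <ᵇ toℕ k then c (f i) (f j) (f k)
      else if toℕ i <ᵇ toℕ k then c (f i) (f k) (f j)
      else c (f k) (f i) (f j)

  K-c : ∀ f i j k → K f i j k ≡ c (f i) (f j) (f k)
  K-c f i j k with toℕ i <ᵇ toℕ j
  ... | true with toℕ j <ᵇ toℕ k
  ... | true = refl
  ... | false with toℕ i <ᵇ toℕ k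
  ... | true = c₂₃ _ _ _
  ... | false = trans (c₁₂ _ _ _) (c₂₃ _ _ _)
  K-c f i j k | false with toℕ i <ᵇ toℕ k
  ... | true = c₁₂ _ _ _
  ... | false with toℕ j <ᵇ toℕ k
  ... | true = trans (c₂₃ _ _ _) (c₁₂ _ _ _)
  ... | false = trans (c₁₂ _ _ _) (trans (c₂₃ _ _ _) (c₁₂ _ _ _))

  unsorted : ∀ f i j k i′ j′ k′ → K f i j k ≢ K f i′ j′ k′ →
    c (f i) (f j) (f k) ≢ c (f i′) (f j′) (f k′)
  unsorted f _ _ _ _ _ _ ne eq = ne (trans (K-c f _ _ _) (trans eq (sym (K-c f _ _ _))))

  -- Stated with `Unique` and `c` rather than with edges, so that distinctness can be transported
  -- along an injection of the seven vertices.
  Path-free : Set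
  Path-free = ∀ {v₁ v₂ v₃ v₄ v₅ v₆ v₇} →
    Unique (v₁ ∷ v₂ ∷ v₃ ∷ v₄ ∷ v₅ ∷ v₆ ∷ v₇ ∷ []) →
    c v₁ v₂ v₃ ≢ c v₃ v₄ v₅ → c v₁ v₂ v₃ ≢ c v₅ v₆ v₇ → c v₃ v₄ v₅ ≢ c v₅ v₆ v₇ → ⊥

  path-free : ¬ RainbowLoosePath col → Path-free
  path-free no-path {v₁} {v₂} {v₃} {v₄} {v₅} {v₆} {v₇}
    ((d12 ∷ d13 ∷ d14 ∷ d15 ∷ d16 ∷ d17 ∷ []) ∷ (d23 ∷ d24 ∷ d25 ∷ d26 ∷ d27 ∷ []) ∷
     (d34 ∷ d35 ∷ d36 ∷ d37 ∷ []) ∷ (d45 ∷ d46 ∷ d47 ∷ []) ∷ (d56 ∷ d57 ∷ []) ∷ (d67 ∷ []) ∷ [] ∷ [])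
    ne₁₂ ne₁₃ ne₂₃ =
    let e₁ , s₁ = spanning d12 d13 d23
        e₂ , s₂ = spanning d34 d35 d45
        e₃ , s₃ = spanning d56 d57 d67
        differ : ∀ {e f p q r p′ q′ r′} → Spans e p q r → Spans f p′ q′ r′ →
          c p q r ≢ c p′ q′ r′ → col e ≢ col f
        differ s t ne eq = ne (trans (c-spans s) (trans eq (sym (c-spans t))))
    in no-path (v₁ , v₂ , v₃ , v₄ , v₅ , v₆ , v₇ ,
      (d12 , d13 , d14 , d15 , d16 , d17 , d23 , d24 , d25 , d26 , d27 , d34 , d35 , d36 , d37 ,
       d45 , d46 , d47 , d56 , d57 , d67) ,
      e₁ , e₂ , e₃ , verts s₁ , verts s₂ , verts s₃ ,
      differ s₁ s₂ ne₁₂ , differ s₁ s₃ ne₁₃ , differ s₂ s₃ ne₂₃)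

  module NoRainbow (7≤n : 7 ≤ n) (pf : Path-free) where

    -- A path is written with the indices 0 to 6. The distinctness of its vertices is then decided
    -- by evaluating `unique?` on `Fin 7` and carried over by injectivity of `f`.
    module Frame {f : Fin 7 → Fin n} (f-injective : Injective _≡_ _≡_ f) where

      private
        clash : ∀ i₁ i₂ i₃ i₄ i₅ i₆ i₇ →
          True (unique? (i₁ ∷ i₂ ∷ i₃ ∷ i₄ ∷ i₅ ∷ i₆ ∷ i₇ ∷ [])) →
          K f i₁ i₂ i₃ ≢ K f i₃ i₄ i₅ → K f i₁ i₂ i₃ ≢ K f i₅ i₆ i₇ → K f i₃ i₄ i₅ ≢ K f i₅ i₆ i₇ → ⊥
        clash i₁ i₂ i₃ i₄ i₅ i₆ i₇ is! ne₁₂ ne₁₃ ne₂₃ =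
          pf (Uniqueₚ.map⁺ f-injective (toWitness is!))
            (unsorted f i₁ i₂ i₃ i₃ i₄ i₅ ne₁₂) (unsorted f i₁ i₂ i₃ i₅ i₆ i₇ ne₁₃)
            (unsorted f i₃ i₄ i₅ i₅ i₆ i₇ ne₂₃)

      -- Path-freeness turned into a restriction on the middle triple, given outer triples of
      -- different colours; `end` does the same for the last triple. Since `K` sorts its indices, a
      -- colour fact fits wherever its triple occurs in a path, whatever the order of its vertices
      -- there.
      mid : ∀ i₁ i₂ i₃ i₄ i₅ i₆ i₇ →
        {True (unique? (i₁ ∷ i₂ ∷ i₃ ∷ i₄ ∷ i₅ ∷ i₆ ∷ i₇ ∷ []))} → ∀ {κ μ} →
        K f i₁ i₂ i₃ ≡ κ → K f i₅ i₆ i₇ ≡ μ → κ ≢ μ → K f i₃ i₄ i₅ ≡ κ ⊎ K f i₃ i₄ i₅ ≡ μ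
      mid i₁ i₂ i₃ i₄ i₅ i₆ i₇ {is!} refl refl κ≢μ
        with K f i₃ i₄ i₅ ≟ⁿ K f i₁ i₂ i₃ | K f i₃ i₄ i₅ ≟ⁿ K f i₅ i₆ i₇
      ... | yes p | _ = inj₁ p
      ... | no _ | yes q = inj₂ q
      ... | no p | no q = ⊥-elim (clash i₁ i₂ i₃ i₄ i₅ i₆ i₇ is! (≢-sym p) κ≢μ q)

      end : ∀ i₁ i₂ i₃ i₄ i₅ i₆ i₇ →
        {True (unique? (i₁ ∷ i₂ ∷ i₃ ∷ i₄ ∷ i₅ ∷ i₆ ∷ i₇ ∷ []))} → ∀ {κ μ} →
        K f i₁ i₂ i₃ ≡ κ → K f i₃ i₄ i₅ ≡ μ → κ ≢ μ → K f i₅ i₆ i₇ ≡ κ ⊎ K f i₅ i₆ i₇ ≡ μ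
      end i₁ i₂ i₃ i₄ i₅ i₆ i₇ {is!} refl refl κ≢μ
        with K f i₅ i₆ i₇ ≟ⁿ K f i₁ i₂ i₃ | K f i₅ i₆ i₇ ≟ⁿ K f i₃ i₄ i₅
      ... | yes p | _ = inj₁ p
      ... | no _ | yes q = inj₂ q
      ... | no p | no q = ⊥-elim (clash i₁ i₂ i₃ i₄ i₅ i₆ i₇ is! κ≢μ (≢-sym p) (≢-sym q))

    -- The triple `s t u` meets each of the other two in `u` alone, so it can start a loose path
    -- through either of them.
    record Seed : Set where
      constructor seed
      field
        {s t u v a b} : Fin n
        unique₆ : Unique (s ∷ t ∷ u ∷ v ∷ a ∷ b ∷ [])
        β≢γ : c u v a ≢ c u v b
        α≢β : c s t u ≢ c u v a
        α≢γ : c s t u ≢ c u v b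

    -- Colours forced by a seed

    module Extended (f : Fin 7 → Fin n) (f-injective : Injective _≡_ _≡_ f)
      {α : ℕ} (xyu≡α : K f X Y U ≡ α)
      (β≢γ : K f U V A ≢ K f U V B) (α≢β : α ≢ K f U V A) (α≢γ : α ≢ K f U V B) where

      open Frame f-injective

      β γ : ℕ
      β = K f U V A
      γ = K f U V B

      abz≡α : K f A B Z ≡ α
      abz≡α = common β≢γ (end X Y U V A B Z xyu≡α refl α≢β) (end X Y U V B A Z xyu≡α refl α≢γ)

      xyv≡α : K f X Y V ≡ α
      xyv≡α = common β≢γ (end Z B A U V X Y abz≡α refl α≢β) (end Z A B U V X Y abz≡α refl α≢γ)

      xyz≡α : K f X Y Z ≡ α
      xyz≡α = common β≢γ (swap (end V U A B Z X Y refl abz≡α (≢-sym α≢β)))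
        (swap (end V U B A Z X Y refl abz≡α (≢-sym α≢γ)))

      xab≡α : K f X A B ≡ α
      xab≡α = common β≢γ (swap (mid U V A B X Y Z refl xyz≡α (≢-sym α≢β)))
        (swap (mid U V B A X Y Z refl xyz≡α (≢-sym α≢γ)))

      yab≡α : K f Y A B ≡ α
      yab≡α = common β≢γ (swap (mid U V A B Y X Z refl xyz≡α (≢-sym α≢β)))
        (swap (mid U V B A Y X Z refl xyz≡α (≢-sym α≢γ)))

      xub∈αβ : K f X U B ≡ α ⊎ K f X U B ≡ β
      xub∈αβ = swap (mid V A U B X Y Z refl xyz≡α (≢-sym α≢β))

      yzu≡α : K f Y Z U ≡ α
      yzu≡α = common β≢γ (end X B A V U Y Z xab≡α refl α≢β) (end X A B V U Y Z xab≡α refl α≢γ)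

      xzu≡α : K f X Z U ≡ α
      xzu≡α = common β≢γ (end Y B A V U X Z yab≡α refl α≢β) (end Y A B V U X Z yab≡α refl α≢γ)

      xua∈αγ : K f X U A ≡ α ⊎ K f X U A ≡ γ
      xua∈αγ = swap (mid V B U A X Y Z refl xyz≡α (≢-sym α≢γ))

      yva∈αγ : K f Y V A ≡ α ⊎ K f Y V A ≡ γ
      yva∈αγ = swap (mid U B V A Y X Z refl xyz≡α (≢-sym α≢γ))

      yzb∈αβ : K f Y Z B ≡ α ⊎ K f Y Z B ≡ β
      yzb∈αβ = swap (end V U A X B Y Z refl xab≡α (≢-sym α≢β))

      -- Swapping A and B moves this triple, so β has to be excluded separately: if YZB had colour
      -- β, then XUA would be forced to γ, and XYV of colour α would join the two into a rainbow
      -- path.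
      yzb≡α : K f Y Z B ≡ α
      yzb≡α with yzb∈αβ
      ... | inj₁ p = p
      ... | inj₂ yzb≡β with common α≢β (swap xua∈αγ) (swap (end Y Z B V U A X yzb≡β refl β≢γ))
      ... | xua≡γ with mid U A X V Y Z B xua≡γ yzb≡β (≢-sym β≢γ)
      ... | inj₁ xyv≡γ = contradiction (trans (sym xyv≡α) xyv≡γ) α≢γ
      ... | inj₂ xyv≡β = contradiction (trans (sym xyv≡α) xyv≡β) α≢β

      -- If both deviated, they would have the different colours β and γ, and YZU of colour α would
      -- connect them. In `xub-xva` the two triples already meet in X, and the same YZU extends them
      -- at U.
      xub-yva : K f X U B ≡ α ⊎ K f Y V A ≡ α
      xub-yva with xub∈αβ | yva∈αγ
      ... | inj₁ p | _ = inj₁ p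
      ... | inj₂ _ | inj₁ q = inj₂ q
      ... | inj₂ p | inj₂ q with mid X B U Z Y A V p q β≢γ
      ... | inj₁ yzu≡β = contradiction (trans (sym yzu≡α) yzu≡β) α≢β
      ... | inj₂ yzu≡γ = contradiction (trans (sym yzu≡α) yzu≡γ) α≢γ

      xub-xva : K f X U B ≡ α ⊎ K f X V A ≡ α
      xub-xva with xub∈αβ | swap (mid U B V A X Y Z refl xyz≡α (≢-sym α≢γ))
      ... | inj₁ p | _ = inj₁ p
      ... | inj₂ _ | inj₁ q = inj₂ q
      ... | inj₂ p | inj₂ q with end A V X B U Y Z q p (≢-sym β≢γ)
      ... | inj₁ yzu≡γ = contradiction (trans (sym yzu≡α) yzu≡γ) α≢γ
      ... | inj₂ yzu≡β = contradiction (trans (sym yzu≡α) yzu≡β) α≢β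

      -- In this and the next two facts the two triples meet in a single vertex, and a triple
      -- already known to have colour α completes the path.
      xuv-uab : Compatible α (K f X U V) (K f U A B)
      xuv-uab = compatible xyz≡α (swap ∘ end B A U V X Y Z refl refl ∘ ≢-sym)

      yuv-xua : Compatible α (K f Y U V) (K f X U A)
      yuv-xua = compatible yzb≡α (swap ∘ end X A U V Y B Z refl refl ∘ ≢-sym)

      uab-xva : Compatible α (K f U A B) (K f X V A)
      uab-xva = compatible yzu≡α (swap ∘ end X V A B U Y Z refl refl ∘ ≢-sym)

    -- Unlike a seed, a kernel singles out no outer pair. It is therefore invariant under exchanging
    -- u with v and a with b (`kernel-uv`, `kernel-ab`), and each fact about one triple yields its
    -- mirror images.
    record Kernel (u v a b : Fin n) (α : ℕ) : Set where
      field
        unique₄ : Unique (u ∷ v ∷ a ∷ b ∷ [])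
        β≢γ : c u v a ≢ c u v b
        α≢β : α ≢ c u v a
        α≢γ : α ≢ c u v b
        spoke : ∀ {x y} → Outside u v a b x → Outside u v a b y → x ≢ y → c x y u ≡ α
    open Kernel

    frame : ∀ {u v a b x y z : Fin n} → Unique (u ∷ v ∷ a ∷ b ∷ []) →
      Outside u v a b x → Outside u v a b y → Outside u v a b z → x ≢ y → x ≢ z → y ≢ z →
      Injective _≡_ _≡_ (lookup (x ∷ y ∷ z ∷ u ∷ v ∷ a ∷ b ∷ []))
    frame uvab! ox oy oz xy xz yz =
      lookup-injective ((xy ∷ xz ∷ ox) ∷ (yz ∷ oy) ∷ oz ∷ uvab!)

    -- The colour α spreads from the triple x y u by exchanging one outer vertex at a time.
    kernel : (σ : Seed) → let open Seed σ in Kernel u v a b (c s t u)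
    kernel (seed {x} {y} {u} {v} {a} {b} ((xy ∷ ox) ∷ oy ∷ uvab!) β≢γ α≢β α≢γ) = record
      { unique₄ = uvab! ; β≢γ = β≢γ ; α≢β = α≢β ; α≢γ = α≢γ ; spoke = spread }
      where
      exchange : ∀ {p q r} → Outside u v a b p → Outside u v a b q → Outside u v a b r →
        p ≢ q → p ≢ r → q ≢ r → c p q u ≡ c x y u → c p r u ≡ c x y u × c q r u ≡ c x y u
      exchange {p} {q} {r} op oq or pq pr qr pqu≡α = E.xzu≡α , E.yzu≡α
        where
        module E = Extended (lookup (p ∷ q ∷ r ∷ u ∷ v ∷ a ∷ b ∷ []))
          (frame uvab! op oq or pq pr qr) pqu≡α β≢γ α≢β α≢γ
      spread : ∀ {p q} → Outside u v a b p → Outside u v a b q → p ≢ q → c p q u ≡ c x y u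
      spread {p} {q} op oq pq with x ≟ᶠ p | y ≟ᶠ p | x ≟ᶠ q | y ≟ᶠ q
      ... | yes refl | _ | _ | yes refl = refl
      ... | yes refl | _ | _ | no yq = proj₁ (exchange ox oy oq xy pq yq refl)
      ... | no _ | yes refl | yes refl | _ = c₁₂ _ _ _
      ... | no _ | yes refl | no xq | _ = proj₂ (exchange ox oy oq xy xq pq refl)
      ... | no xp | no yp | yes refl | _ = trans (c₁₂ _ _ _) (proj₁ (exchange ox oy op xy xp yp refl))
      ... | no xp | no yp | no xq | _ =
        proj₂ (exchange ox op oq xp xq pq (proj₁ (exchange ox oy op xy xp yp refl)))

    one-outside : ∀ {u v a b : Fin n} → ∃ λ x → Outside u v a b x
    one-outside {u} {v} {a} {b} = fresh (u ∷ v ∷ a ∷ b ∷ []) (ℕₚ.≤-trans (ℕₚ.m≤n+m 5 2) 7≤n)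

    -- The two given vertices may coincide: `another ox ox` asks for a second outer vertex. At most
    -- six vertices are avoided, which is what `7 ≤ n` allows.
    another : ∀ {u v a b x y : Fin n} → Outside u v a b x → Outside u v a b y →
      ∃ λ z → Outside u v a b z × x ≢ z × y ≢ z
    another {u} {v} {a} {b} {x} {y} _ _ with fresh (x ∷ y ∷ u ∷ v ∷ a ∷ b ∷ []) 7≤n
    ... | z , (zx ∷ zy ∷ oz) = z , oz , ≢-sym zx , ≢-sym zy

    kernel-uv : ∀ {u v a b α} → Kernel u v a b α → Kernel v u a b α
    kernel-ab : ∀ {u v a b α} → Kernel u v a b α → Kernel u v b a α

    module KernelColours {u v a b : Fin n} {α : ℕ} (k : Kernel u v a b α) where

      Out : Fin n → Set
      Out = Outside u v a b

      module At {x y z} (ox : Out x) (oy : Out y) (oz : Out z) (xy : x ≢ y) (xz : x ≢ z) (yz : y ≢ z) where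
        open Extended (lookup (x ∷ y ∷ z ∷ u ∷ v ∷ a ∷ b ∷ [])) (frame (unique₄ k) ox oy oz xy xz yz)
          (spoke k ox oy xy) (β≢γ k) (α≢β k) (α≢γ k) public

      xyv≡α : ∀ {x y} → Out x → Out y → x ≢ y → c x y v ≡ α
      xyv≡α ox oy xy = let _ , oz , xz , yz = another ox oy in At.xyv≡α ox oy oz xy xz yz

      xyb≡α : ∀ {x y} → Out x → Out y → x ≢ y → c x y b ≡ α
      xyb≡α ox oy xy = let _ , ow , xw , yw = another ox oy in
        -- The fresh vertex takes the place of X, so that `x` and `y` take those of Y and Z.
        At.yzb≡α ow ox oy (≢-sym xw) (≢-sym yw) xy

      xyz≡α : ∀ {x y z} → Out x → Out y → Out z → x ≢ y → x ≢ z → y ≢ z → c x y z ≡ α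
      xyz≡α = At.xyz≡α

      xab≡α : ∀ {x} → Out x → c x a b ≡ α
      xab≡α ox = let _ , oy , xy , _ = another ox ox ; _ , oz , xz , yz = another ox oy in
        At.xab≡α ox oy oz xy xz yz

      xua∈αγ : ∀ {x} → Out x → c x u a ≡ α ⊎ c x u a ≡ c u v b
      xua∈αγ ox = let _ , oy , xy , _ = another ox ox ; _ , oz , xz , yz = another ox oy in
        At.xua∈αγ ox oy oz xy xz yz

      xub∈αβ : ∀ {x} → Out x → c x u b ≡ α ⊎ c x u b ≡ c u v a
      xub∈αβ ox = let _ , oy , xy , _ = another ox ox ; _ , oz , xz , yz = another ox oy in
        At.xub∈αβ ox oy oz xy xz yz

      xuv-uab : ∀ {x} → Out x → Compatible α (c x u v) (c u a b)
      xuv-uab ox = let _ , oy , xy , _ = another ox ox ; _ , oz , xz , yz = another ox oy in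
        At.xuv-uab ox oy oz xy xz yz

      xuv-yua : ∀ {x y} → Out x → Out y → x ≢ y → Compatible α (c x u v) (c y u a)
      xuv-yua ox oy xy = let _ , oz , xz , yz = another ox oy in At.yuv-xua oy ox oz (≢-sym xy) yz xz

      uab-xva : ∀ {x} → Out x → Compatible α (c u a b) (c x v a)
      uab-xva ox = let _ , oy , xy , _ = another ox ox ; _ , oz , xz , yz = another ox oy in
        At.uab-xva ox oy oz xy xz yz

      xub-yva : ∀ {x y} → Out x → Out y → c x u b ≡ α ⊎ c y v a ≡ α
      xub-yva {x} {y} ox oy with x ≟ᶠ y
      ... | no xy = let _ , oz , xz , yz = another ox oy in At.xub-yva ox oy oz xy xz yz
      ... | yes refl = let _ , oy , xy , _ = another ox ox ; _ , oz , xz , yz = another ox oy in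
        At.xub-xva ox oy oz xy xz yz

    kernel-uv {u} {v} {a} {b} k = record
      { unique₄ = unique-uv (unique₄ k)
      ; β≢γ = λ eq → β≢γ k (trans (c₁₂ u v a) (trans eq (c₁₂ v u b)))
      ; α≢β = λ eq → α≢β k (trans eq (c₁₂ v u a))
      ; α≢γ = λ eq → α≢γ k (trans eq (c₁₂ v u b))
      ; spoke = λ ox oy → KernelColours.xyv≡α k (outside-uv ox) (outside-uv oy)
      }

    kernel-ab k = record
      { unique₄ = unique-ab (unique₄ k)
      ; β≢γ = ≢-sym (β≢γ k)
      ; α≢β = α≢γ k
      ; α≢γ = α≢β k
      ; spoke = λ ox oy → spoke k (outside-ab ox) (outside-ab oy)
      }

    -- Triples that may deviate from α

    data Special (u v a b : Fin n) (e : Edge n) : Set where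
      uva : Spans e u v a → Special u v a b e
      uvb : Spans e u v b → Special u v a b e
      uab : Spans e u a b → Special u v a b e
      vab : Spans e v a b → Special u v a b e
      xuv : ∀ {x} → Outside u v a b x → Spans e x u v → Special u v a b e
      xua : ∀ {x} → Outside u v a b x → Spans e x u a → Special u v a b e
      xub : ∀ {x} → Outside u v a b x → Spans e x u b → Special u v a b e
      xva : ∀ {x} → Outside u v a b x → Spans e x v a → Special u v a b e
      xvb : ∀ {x} → Outside u v a b x → Spans e x v b → Special u v a b e

    classify : ∀ {u v a b α} → Kernel u v a b α → (e : Edge n) → col e ≡ α ⊎ Special u v a b e
    classify {u} {v} {a} {b} {α} k e with shape (unique₄ k) e
    ... | uva s = inj₂ (uva s)
    ... | uvb s = inj₂ (uvb s)
    ... | uab s = inj₂ (uab s)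
    ... | vab s = inj₂ (vab s)
    ... | xuv o s = inj₂ (xuv o s)
    ... | xua o s = inj₂ (xua o s)
    ... | xub o s = inj₂ (xub o s)
    ... | xva o s = inj₂ (xva o s)
    ... | xvb o s = inj₂ (xvb o s)
    ... | xab o s = inj₁ (trans (sym (c-spans s)) (KernelColours.xab≡α k o))
    ... | xyu o o′ s = inj₁ (trans (sym (c-spans s)) (spoke k o o′ (p≢q s)))
    ... | xyv o o′ s = inj₁ (trans (sym (c-spans s)) (KernelColours.xyv≡α k o o′ (p≢q s)))
    ... | xya o o′ s = inj₁ (trans (sym (c-spans s))
      (KernelColours.xyb≡α (kernel-ab k) (outside-ab o) (outside-ab o′) (p≢q s)))
    ... | xyb o o′ s = inj₁ (trans (sym (c-spans s)) (KernelColours.xyb≡α k o o′ (p≢q s)))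
    ... | xyz o o′ o″ s = inj₁ (trans (sym (c-spans s))
      (KernelColours.xyz≡α k o o′ o″ (p≢q s) (p≢r s) (q≢r s)))

    -- A seed from a third colour in any position

    module ThirdColour {f : Fin 7 → Fin n} (f-injective : Injective _≡_ _≡_ f) {κ : ℕ}
      (β≢γ : K f U V A ≢ K f U V B) (κ≢β : κ ≢ K f U V A) (κ≢γ : κ ≢ K f U V B) where

      open Frame f-injective

      private
        β≢κ : K f U V A ≢ κ
        β≢κ = ≢-sym κ≢β

        γ≢κ : K f U V B ≢ κ
        γ≢κ = ≢-sym κ≢γ

        seed-at : ∀ u v a b x y → {True (unique? (x ∷ y ∷ u ∷ v ∷ a ∷ b ∷ []))} →
          ∀ {λ₁ λ₂ λ₃} → K f u v a ≡ λ₁ → K f u v b ≡ λ₂ → K f x y u ≡ λ₃ →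
          λ₁ ≢ λ₂ → λ₃ ≢ λ₁ → λ₃ ≢ λ₂ → Seed
        seed-at u v a b x y {is!} refl refl refl ne₁₂ ne₃₁ ne₃₂ =
          seed (Uniqueₚ.map⁺ f-injective (toWitness is!))
            (unsorted f u v a u v b ne₁₂) (unsorted f x y u u v a ne₃₁) (unsorted f x y u u v b ne₃₂)

        -- Either a seed appears, or the triple x y u takes one of the two given colours.
        restrict : ∀ u v a b x y → {True (unique? (x ∷ y ∷ u ∷ v ∷ a ∷ b ∷ []))} →
          ∀ {λ₁ λ₂} → K f u v a ≡ λ₁ → K f u v b ≡ λ₂ → λ₁ ≢ λ₂ →
          (K f x y u ≡ λ₁ ⊎ K f x y u ≡ λ₂ → Seed) → Seed
        restrict u v a b x y {is!} {λ₁} {λ₂} uva≡ uvb≡ ne continue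
          with K f x y u ≟ⁿ λ₁ | K f x y u ≟ⁿ λ₂
        ... | yes p | _ = continue (inj₁ p)
        ... | no _ | yes q = continue (inj₂ q)
        ... | no p | no q = seed-at u v a b x y {is!} uva≡ uvb≡ refl ne p q

      seed-xyu : K f X Y U ≡ κ → Seed
      seed-xyu xyu≡κ = seed-at U V A B X Y refl refl xyu≡κ β≢γ κ≢β κ≢γ

      seed-xab : K f X A B ≡ κ → Seed
      seed-xab xab≡κ = seed-at U V A B Y Z refl refl yzu≡κ β≢γ κ≢β κ≢γ
        where
        yzu≡κ : K f Y Z U ≡ κ
        yzu≡κ = common β≢γ (end X B A V U Y Z xab≡κ refl κ≢β) (end X A B V U Y Z xab≡κ refl κ≢γ)

      seed-xyz : K f X Y Z ≡ κ → Seed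
      seed-xyz xyz≡κ = seed-xyu
        (common β≢γ (end Z B A V U X Y abz≡κ refl κ≢β) (end Z A B V U X Y abz≡κ refl κ≢γ))
        where
        abz≡κ : K f A B Z ≡ κ
        abz≡κ = common β≢γ (swap (mid U V A B Z X Y refl xyz≡κ β≢κ))
          (swap (mid U V B A Z X Y refl xyz≡κ γ≢κ))

      -- The target XZU is confined once by a path ending in XYA and once by a path ending in YZB,
      -- so κ is first passed on to YZB.
      seed-xya : K f X Y A ≡ κ → Seed
      seed-xya xya≡κ = seed-at U V A B X Z refl refl xzu≡κ β≢γ κ≢β κ≢γ
        where
        yzb≡κ : K f Y Z B ≡ κ
        yzb≡κ = common β≢γ (swap (end U V A X Y B Z refl xya≡κ β≢κ))
          (swap (mid U V B Z Y X A refl xya≡κ γ≢κ))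
        xzu≡κ : K f X Z U ≡ κ
        xzu≡κ = common β≢γ (swap (mid V A U X Z Y B refl yzb≡κ β≢κ))
          (swap (mid V B U Z X Y A refl xya≡κ γ≢κ))

      -- UVA, UVB and UAB have three different colours, and any two of them share two vertices
      -- including U. XYU avoids at least two of these colours, and it forms a seed with the two
      -- triples that carry them. `seed-xuv` argues alike with UVA, UVB, UVX and the triple YZU.
      seed-uab : K f U A B ≡ κ → Seed
      seed-uab uab≡κ with K f X Y U ≟ⁿ K f U V A | K f X Y U ≟ⁿ K f U V B
      ... | no p | no q = seed-at U V A B X Y refl refl refl β≢γ p q
      ... | yes p | _ = seed-at U B V A X Y refl uab≡κ p γ≢κ β≢γ β≢κ
      ... | no _ | yes q = seed-at U A V B X Y refl uab≡κ q β≢κ (≢-sym β≢γ) γ≢κ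

      seed-xuv : K f X U V ≡ κ → Seed
      seed-xuv xuv≡κ with K f Y Z U ≟ⁿ K f U V A | K f Y Z U ≟ⁿ K f U V B
      ... | no p | no q = seed-at U V A B Y Z refl refl refl β≢γ p q
      ... | yes p | _ = seed-at U V B X Y Z refl xuv≡κ p γ≢κ β≢γ β≢κ
      ... | no _ | yes q = seed-at U V A X Y Z refl xuv≡κ q β≢κ (≢-sym β≢γ) γ≢κ

      -- Each of YZV, YZA, BYU and XZV either completes a seed or keeps two colours. If none
      -- completes one, paths reduce their colours to γ, κ, κ, γ, and then YBU, UAV, VXZ is rainbow
      -- with colours κ, β, γ.
      seed-xua : K f X U A ≡ κ → Seed
      seed-xua xua≡κ =
        restrict V U A B Y Z refl refl β≢γ λ yzv∈βγ →
        restrict A U V X Y Z refl xua≡κ β≢κ λ yza∈βκ →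
        restrict U A V X B Y refl xua≡κ β≢κ λ byu∈βκ →
        restrict V U A B X Z refl refl β≢γ λ xzv∈βγ →
        let
          yzv≡γ : K f Y Z V ≡ K f U V B
          yzv≡γ = common β≢κ (swap yzv∈βγ) (swap (end X A U B V Y Z xua≡κ refl κ≢γ))
          yza≡κ : K f Y Z A ≡ κ
          yza≡κ = common β≢γ (swap yza∈βκ) (swap (end V B U X A Y Z refl xua≡κ γ≢κ))
          byu≡κ : K f B Y U ≡ κ
          byu≡κ = common β≢γ (swap byu∈βκ) (swap (mid V Z Y B U A X yzv≡γ xua≡κ γ≢κ))
          xzv≡γ : K f X Z V ≡ K f U V B
          xzv≡γ = common β≢κ (swap xzv∈βγ) (swap (mid A Y Z X V U B yza≡κ refl κ≢γ))
        in [ (λ xzv≡κ → contradiction (trans (sym xzv≡κ) xzv≡γ) κ≢γ)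
           , (λ xzv≡β → contradiction (trans (sym xzv≡β) xzv≡γ) β≢γ)
           ]′ (end Y B U A V X Z byu≡κ refl κ≢β)

    record Trichromatic (u v a b : Fin n) (e : Edge n) : Set where
      field
        uvab! : Unique (u ∷ v ∷ a ∷ b ∷ [])
        uva≢uvb : c u v a ≢ c u v b
        e≢uva : col e ≢ c u v a
        e≢uvb : col e ≢ c u v b

    module _ {u v a b : Fin n} {e : Edge n} where

      trichromatic-uv : Trichromatic u v a b e → Trichromatic v u a b e
      trichromatic-uv t = record
        { uvab! = unique-uv uvab!
        ; uva≢uvb = λ eq → uva≢uvb (trans (c₁₂ u v a) (trans eq (c₁₂ v u b)))
        ; e≢uva = λ eq → e≢uva (trans eq (c₁₂ v u a))
        ; e≢uvb = λ eq → e≢uvb (trans eq (c₁₂ v u b))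
        } where open Trichromatic t

      trichromatic-ab : Trichromatic u v a b e → Trichromatic u v b a e
      trichromatic-ab t = record
        { uvab! = unique-ab uvab! ; uva≢uvb = ≢-sym uva≢uvb ; e≢uva = e≢uvb ; e≢uvb = e≢uva }
        where open Trichromatic t

    module FromTrichromatic {u v a b : Fin n} {e : Edge n} (t : Trichromatic u v a b e) where

      open Trichromatic t

      private
        Out : Fin n → Set
        Out = Outside u v a b

        module At {x y z} (ox : Out x) (oy : Out y) (oz : Out z) (xy : x ≢ y) (xz : x ≢ z) (yz : y ≢ z) =
          ThirdColour (frame uvab! ox oy oz xy xz yz) uva≢uvb e≢uva e≢uvb

      from-xyz : ∀ {x y z} → Out x → Out y → Out z → Spans e x y z → Seed
      from-xyz ox oy oz s = At.seed-xyz ox oy oz (p≢q s) (p≢r s) (q≢r s) (c-spans s)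

      from-xyu : ∀ {x y} → Out x → Out y → Spans e x y u → Seed
      from-xyu ox oy s = let _ , oz , xz , yz = another ox oy in
        At.seed-xyu ox oy oz (p≢q s) xz yz (c-spans s)

      from-xya : ∀ {x y} → Out x → Out y → Spans e x y a → Seed
      from-xya ox oy s = let _ , oz , xz , yz = another ox oy in
        At.seed-xya ox oy oz (p≢q s) xz yz (c-spans s)

      from-xuv : ∀ {x} → Out x → Spans e x u v → Seed
      from-xuv ox s = let _ , oy , xy , _ = another ox ox ; _ , oz , xz , yz = another ox oy in
        At.seed-xuv ox oy oz xy xz yz (c-spans s)

      from-xua : ∀ {x} → Out x → Spans e x u a → Seed
      from-xua ox s = let _ , oy , xy , _ = another ox ox ; _ , oz , xz , yz = another ox oy in
        At.seed-xua ox oy oz xy xz yz (c-spans s)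

      from-xab : ∀ {x} → Out x → Spans e x a b → Seed
      from-xab ox s = let _ , oy , xy , _ = another ox ox ; _ , oz , xz , yz = another ox oy in
        At.seed-xab ox oy oz xy xz yz (c-spans s)

      from-uab : Spans e u a b → Seed
      from-uab s =
        let _ , ox = one-outside ; _ , oy , xy , _ = another ox ox ; _ , oz , xz , yz = another ox oy in
        At.seed-uab ox oy oz xy xz yz (c-spans s)

    trichromatic⇒seed : ∀ {u v a b e} → Trichromatic u v a b e → Seed
    trichromatic⇒seed {e = e} t with shape (Trichromatic.uvab! t) e
    ... | uva s = contradiction (sym (c-spans s)) (Trichromatic.e≢uva t)
    ... | uvb s = contradiction (sym (c-spans s)) (Trichromatic.e≢uvb t)
    ... | uab s = FromTrichromatic.from-uab t s
    ... | vab s = FromTrichromatic.from-uab (trichromatic-uv t) s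
    ... | xuv o s = FromTrichromatic.from-xuv t o s
    ... | xua o s = FromTrichromatic.from-xua t o s
    ... | xub o s = FromTrichromatic.from-xua (trichromatic-ab t) (outside-ab o) s
    ... | xva o s = FromTrichromatic.from-xua (trichromatic-uv t) (outside-uv o) s
    ... | xvb o s = FromTrichromatic.from-xua (trichromatic-ab (trichromatic-uv t)) (outside-ab (outside-uv o)) s
    ... | xab o s = FromTrichromatic.from-xab t o s
    ... | xyu o o′ s = FromTrichromatic.from-xyu t o o′ s
    ... | xyv o o′ s = FromTrichromatic.from-xyu (trichromatic-uv t) (outside-uv o) (outside-uv o′) s
    ... | xya o o′ s = FromTrichromatic.from-xya t o o′ s
    ... | xyb o o′ s = FromTrichromatic.from-xya (trichromatic-ab t) (outside-ab o) (outside-ab o′) s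
    ... | xyz o o′ o″ s = FromTrichromatic.from-xyz t o o′ o″ s

    -- Reading off the three cases

    -- The list may repeat colours, so a bound needs no case split on whether the listed colours
    -- coincide.
    colours-bound : (L : List ℕ) → (∀ e → col e ∈ L) → numColours col ≤ length L
    colours-bound L col∈L = unique-⊆⇒length≤ (deduplicate-! _≟ⁿ_ _) λ w∈ →
      let e , _ , w≡ = ∈-map⁻ col (∈-deduplicate⁻ _≟ⁿ_ (map col (allEdges n)) w∈)
      in subst (_∈ L) (sym w≡) (col∈L e)

    module Conclusions (3≤colours : 3 ≤ numColours col) where

      Conclusion : Set
      Conclusion = Σ ℕ λ α → Used col α × (CaseI col α ⊎ CaseII col ⊎ CaseIII col α)

      three-to-five : numColours col ≤ 5 →
        (numColours col ≡ 3) ⊎ (numColours col ≡ 4) ⊎ (numColours col ≡ 5)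
      three-to-five ≤5 = go 3≤colours ≤5
        where
        go : ∀ {m} → 3 ≤ m → m ≤ 5 → (m ≡ 3) ⊎ (m ≡ 4) ⊎ (m ≡ 5)
        go {3} _ _ = inj₁ refl
        go {4} _ _ = inj₂ (inj₁ refl)
        go {5} _ _ = inj₂ (inj₂ refl)
        go {1} (s≤s ()) _
        go {2} (s≤s (s≤s ())) _
        go {suc (suc (suc (suc (suc (suc _)))))} _ (s≤s (s≤s (s≤s (s≤s (s≤s ())))))

      module FromKernel {u v a b : Fin n} {α : ℕ} (k : Kernel u v a b α) where

        open KernelColours k public
        private
          module KV = KernelColours (kernel-uv k)

        used : Used col α
        used =
          let _ , ox = one-outside
              _ , oy , xy , _ = another ox ox
              e , s = spanning xy (All.head ox) (All.head oy)
          in e , trans (sym (c-spans s)) (spoke k ox oy xy)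

        xva∈αγ : ∀ {x} → Out x → c x v a ≡ α ⊎ c x v a ≡ c u v b
        xva∈αγ {x} ox = subst (λ κ → c x v a ≡ α ⊎ c x v a ≡ κ) (c₁₂ v u b) (KV.xua∈αγ (outside-uv ox))

        xvb∈αβ : ∀ {x} → Out x → c x v b ≡ α ⊎ c x v b ≡ c u v a
        xvb∈αβ {x} ox = subst (λ κ → c x v b ≡ α ⊎ c x v b ≡ κ) (c₁₂ v u a) (KV.xub∈αβ (outside-uv ox))

        xuv-vab : ∀ {x} → Out x → Compatible α (c x u v) (c v a b)
        xuv-vab ox = subst (λ κ → Compatible α κ (c v a b)) (c₂₃ _ v u) (KV.xuv-uab (outside-uv ox))

        xuv-yva : ∀ {x y} → Out x → Out y → x ≢ y → Compatible α (c x u v) (c y v a)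
        xuv-yva ox oy xy = subst (λ κ → Compatible α κ (c _ v a)) (c₂₃ _ v u)
          (KV.xuv-yua (outside-uv ox) (outside-uv oy) xy)

        vab-xua : ∀ {x} → Out x → Compatible α (c v a b) (c x u a)
        vab-xua ox = KV.uab-xva (outside-uv ox)

        xvb-yua : ∀ {x y} → Out x → Out y → c x v b ≡ α ⊎ c y u a ≡ α
        xvb-yua ox oy = KV.xub-yva (outside-uv ox) (outside-uv oy)

        out? : ∀ w → Dec (Out w)
        out? w = All.all? (λ t → ¬? (w ≟ᶠ t)) _

        constant : (g : Fin n → ℕ) →
          (∀ {x} → Out x → g x ≡ α) ⊎ (∃ λ x → Out x × g x ≢ α)
        constant g with any? (λ x → out? x ×-dec ¬? (g x ≟ⁿ α))
        ... | yes deviant = inj₂ deviant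
        ... | no none = inj₁ λ {x} ox → decidable-stable (g x ≟ⁿ α) λ ne → none (x , ox , ne)

        -- `L` holds the colours that no path confines to the first three; two of them give the
        -- bound five, none gives exactly three.
        palette : List ℕ → List ℕ
        palette L = α ∷ c u v a ∷ c u v b ∷ L

        module _ {L : List ℕ} where

          αβ∈ : ∀ {κ} → κ ≡ α ⊎ κ ≡ c u v a → κ ∈ palette L
          αβ∈ (inj₁ p) = here p
          αβ∈ (inj₂ p) = there (here p)

          αγ∈ : ∀ {κ} → κ ≡ α ⊎ κ ≡ c u v b → κ ∈ palette L
          αγ∈ (inj₁ p) = here p
          αγ∈ (inj₂ p) = there (there (here p))

          in-palette : c u a b ∈ palette L → c v a b ∈ palette L →
            (∀ {x} → Out x → c x u v ∈ palette L) → ∀ e → col e ∈ palette L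
          in-palette uab∈ vab∈ xuv∈ e with classify k e
          ... | inj₁ eq = here eq
          ... | inj₂ (uva s) = subst (_∈ palette L) (c-spans s) (αβ∈ (inj₂ refl))
          ... | inj₂ (uvb s) = subst (_∈ palette L) (c-spans s) (αγ∈ (inj₂ refl))
          ... | inj₂ (uab s) = subst (_∈ palette L) (c-spans s) uab∈
          ... | inj₂ (vab s) = subst (_∈ palette L) (c-spans s) vab∈
          ... | inj₂ (xuv o s) = subst (_∈ palette L) (c-spans s) (xuv∈ o)
          ... | inj₂ (xua o s) = subst (_∈ palette L) (c-spans s) (αγ∈ (xua∈αγ o))
          ... | inj₂ (xub o s) = subst (_∈ palette L) (c-spans s) (αβ∈ (xub∈αβ o))
          ... | inj₂ (xva o s) = subst (_∈ palette L) (c-spans s) (αγ∈ (xva∈αγ o))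
          ... | inj₂ (xvb o s) = subst (_∈ palette L) (c-spans s) (αβ∈ (xvb∈αβ o))

        is-α : ∀ {e p q r} → Spans e p q r → c p q r ≡ α → col e ≡ α
        is-α s = trans (sym (c-spans s))

        case-II : (L : List ℕ) → length L ≤ 2 → (∀ e → col e ∈ palette L) →
          (e₀ : Edge n) → (∀ f → ¬ (u ∈ₑ f) → (just e₀ ≡ just f) ⊎ (col f ≡ α)) → Conclusion
        case-II L L≤2 col∈ e₀ only-e₀ = α , used , inj₂ (inj₁
          (three-to-five (ℕₚ.≤-trans (colours-bound (palette L) col∈) (s≤s (s≤s (s≤s L≤2)))) ,
            u , just e₀ , α , only-e₀))

        -- Under these hypotheses the only triple that misses u and may deviate is vab, which
        -- becomes the exceptional edge of (ii).
        module OneSided (va : ∀ {x} → Out x → c x v a ≡ α) (vb : ∀ {x} → Out x → c x v b ≡ α) where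

          case-II-vab : (L : List ℕ) → length L ≤ 2 → (∀ e → col e ∈ palette L) → Conclusion
          case-II-vab L L≤2 col∈ with unique₄ k
          ... | _ ∷ (v≢a ∷ v≢b ∷ []) ∷ (a≢b ∷ []) ∷ _ = case-II L L≤2 col∈ e₀ only-e₀
            where
            e₀ : Edge n
            e₀ = proj₁ (spanning v≢a v≢b a≢b)
            only-e₀ : ∀ f → ¬ (u ∈ₑ f) → (just e₀ ≡ just f) ⊎ (col f ≡ α)
            only-e₀ f u∉f with classify k f
            ... | inj₁ eq = inj₂ eq
            ... | inj₂ (uva s) = contradiction (first∈ s) u∉f
            ... | inj₂ (uvb s) = contradiction (first∈ s) u∉f
            ... | inj₂ (uab s) = contradiction (first∈ s) u∉f
            ... | inj₂ (vab s) = inj₁ (cong just (spans-unique (proj₂ (spanning v≢a v≢b a≢b)) s))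
            ... | inj₂ (xuv o s) = contradiction (second∈ s) u∉f
            ... | inj₂ (xua o s) = contradiction (second∈ s) u∉f
            ... | inj₂ (xub o s) = contradiction (second∈ s) u∉f
            ... | inj₂ (xva o s) = inj₂ (is-α s (va o))
            ... | inj₂ (xvb o s) = inj₂ (is-α s (vb o))

          -- The deviating xua has the colour of uvb and meets vab, and each yuv with y different
          -- from x, in one vertex. All of these are thus confined, and only xuv and uab can bring
          -- further colours.
          from-xua : ∀ {x} → Out x → c x u a ≢ α → Conclusion
          from-xua {x} ox xua≢α = case-II-vab (c x u v ∷ c u a b ∷ []) ℕₚ.≤-refl
            (in-palette (there (there (there (there (here refl)))))
              (αγ∈ (follow (vab-xua ox) xua≢α (xua∈αγ ox))) yuv∈)
            where
            yuv∈ : ∀ {y} → Out y → c y u v ∈ palette (c x u v ∷ c u a b ∷ [])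
            yuv∈ {y} oy with y ≟ᶠ x
            ... | yes refl = there (there (there (here refl)))
            ... | no yx = αγ∈ (follow (xuv-yua oy ox yx) xua≢α (xua∈αγ ox))

          module _ (ua : ∀ {x} → Out x → c x u a ≡ α) (ub : ∀ {x} → Out x → c x u b ≡ α) where

            case-I : c u a b ≡ α → c v a b ≡ α → Conclusion
            case-I uab≡α vab≡α with unique₄ k
            ... | (u≢v ∷ _) ∷ _ = α , used , inj₁ (u , v , u≢v , through)
              where
              through : ∀ e → col e ≢ α → (u ∈ₑ e) × (v ∈ₑ e)
              through e ne with classify k e
              ... | inj₁ eq = contradiction eq ne
              ... | inj₂ (uva s) = first∈ s , second∈ s
              ... | inj₂ (uvb s) = first∈ s , second∈ s
              ... | inj₂ (xuv o s) = second∈ s , third∈ s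
              ... | inj₂ (uab s) = contradiction (is-α s uab≡α) ne
              ... | inj₂ (vab s) = contradiction (is-α s vab≡α) ne
              ... | inj₂ (xua o s) = contradiction (is-α s (ua o)) ne
              ... | inj₂ (xub o s) = contradiction (is-α s (ub o)) ne
              ... | inj₂ (xva o s) = contradiction (is-α s (va o)) ne
              ... | inj₂ (xvb o s) = contradiction (is-α s (vb o)) ne

            from-uab-vab : Conclusion
            from-uab-vab with c u a b ≟ⁿ α | c v a b ≟ⁿ α
            ... | yes p | yes q = case-I p q
            -- The deviating uab meets every xuv in u alone, so all triples xuv together add no
            -- colour beyond α and that of uab.
            ... | no uab≢α | _ = case-II-vab (c u a b ∷ c v a b ∷ []) ℕₚ.≤-refl
              (in-palette uab∈ (there (there (there (there (here refl)))))
                (λ ox → agree (xuv-uab ox)))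
              where
              uab∈ : c u a b ∈ palette (c u a b ∷ c v a b ∷ [])
              uab∈ = there (there (there (here refl)))
              agree : ∀ {κ} → Compatible α κ (c u a b) → κ ∈ palette (c u a b ∷ c v a b ∷ [])
              agree (inj₁ p) = here p
              agree (inj₂ (inj₁ p)) = contradiction p uab≢α
              agree (inj₂ (inj₂ refl)) = uab∈
            ... | yes uab≡α | no vab≢α = case-II-vab (c v a b ∷ []) (s≤s z≤n)
              (in-palette (here uab≡α) vab∈ (λ ox → agree (xuv-vab ox)))
              where
              vab∈ : c v a b ∈ palette (c v a b ∷ [])
              vab∈ = there (there (there (here refl)))
              agree : ∀ {κ} → Compatible α κ (c v a b) → κ ∈ palette (c v a b ∷ [])
              agree (inj₁ p) = here p
              agree (inj₂ (inj₁ p)) = contradiction p vab≢α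
              agree (inj₂ (inj₂ refl)) = vab∈

        -- The deviating yva forces all tub to α, the deviating xua all tvb, and they confine uab
        -- and vab respectively. Only the triples tuv remain open.
        module TwoSided {x y : Fin n} (ox : Out x) (oy : Out y)
          (xua≢α : c x u a ≢ α) (yva≢α : c y v a ≢ α) where

          ub : ∀ {t} → Out t → c t u b ≡ α
          ub ot = [ id , (λ yva≡α → contradiction yva≡α yva≢α) ]′ (xub-yva ot oy)

          vb : ∀ {t} → Out t → c t v b ≡ α
          vb ot = [ id , (λ xua≡α → contradiction xua≡α xua≢α) ]′ (xvb-yua ot ox)

          uab∈αγ : c u a b ≡ α ⊎ c u a b ≡ c u v b
          uab∈αγ = follow (uab-xva oy) yva≢α (xva∈αγ oy)

          vab∈αγ : c v a b ≡ α ⊎ c v a b ≡ c u v b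
          vab∈αγ = follow (vab-xua ox) xua≢α (xua∈αγ ox)

          αγ? : ∀ κ → Dec (κ ≡ α ⊎ κ ≡ c u v b)
          αγ? κ = (κ ≟ⁿ α) ⊎-dec (κ ≟ⁿ c u v b)

          -- The colour of suv lies outside the confinement of tua and tva, hence forces these to α
          -- for every t other than s, and vab too. So x is s, and sva is the only triple missing u
          -- that may deviate. The colour of suv may also be that of uva; the palette then lists it
          -- twice.
          from-fourth-colour : ∀ {s} → Out s → ¬ (c s u v ≡ α ⊎ c s u v ≡ c u v b) → Conclusion
          from-fourth-colour {s} os suv∉αγ with unique₄ k
          ... | _ ∷ (v≢a ∷ _) ∷ _ = case-II (c s u v ∷ []) (s≤s z≤n)
            (in-palette (αγ∈ uab∈αγ) (αγ∈ vab∈αγ) tuv∈) e₀ only-e₀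
            where
            tua≡α : ∀ {t} → Out t → s ≢ t → c t u a ≡ α
            tua≡α ot st = resist (xuv-yua os ot st) suv∉αγ (xua∈αγ ot)
            tva≡α : ∀ {t} → Out t → s ≢ t → c t v a ≡ α
            tva≡α ot st = resist (xuv-yva os ot st) suv∉αγ (xva∈αγ ot)
            tuv∈ : ∀ {t} → Out t → c t u v ∈ palette (c s u v ∷ [])
            tuv∈ {t} ot with t ≟ᶠ s | s ≟ᶠ x
            ... | yes refl | _ = there (there (there (here refl)))
            ... | no ts | yes refl = αγ∈ (follow (xuv-yua ot ox ts) xua≢α (xua∈αγ ox))
            ... | no _ | no sx = contradiction (tua≡α ox sx) xua≢α
            s-va : ∃ λ e → Spans e s v a
            s-va = spanning (All.head (All.tail os)) (All.head (All.tail (All.tail os))) v≢a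
            e₀ : Edge n
            e₀ = proj₁ s-va
            only-e₀ : ∀ f → ¬ (u ∈ₑ f) → (just e₀ ≡ just f) ⊎ (col f ≡ α)
            only-e₀ f u∉f with classify k f
            ... | inj₁ eq = inj₂ eq
            ... | inj₂ (uva t) = contradiction (first∈ t) u∉f
            ... | inj₂ (uvb t) = contradiction (first∈ t) u∉f
            ... | inj₂ (uab t) = contradiction (first∈ t) u∉f
            ... | inj₂ (vab t) = inj₂ (is-α t (resist (xuv-vab os) suv∉αγ vab∈αγ))
            ... | inj₂ (xuv o t) = contradiction (second∈ t) u∉f
            ... | inj₂ (xua o t) = contradiction (second∈ t) u∉f
            ... | inj₂ (xub o t) = contradiction (second∈ t) u∉f
            ... | inj₂ (xvb o t) = inj₂ (is-α t (vb o))
            ... | inj₂ (xva {w} o t) with s ≟ᶠ w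
            ... | yes refl = inj₁ (cong just (spans-unique (proj₂ s-va) t))
            ... | no sw = inj₂ (is-α t (tva≡α o sw))

          -- The distinguished edge is uva. The special shapes meeting it in one vertex are xub and
          -- xvb, which have colour α here; every other special triple arises from uva by replacing
          -- at most one vertex.
          case-III : (∀ {t} → Out t → c t u v ≡ α ⊎ c t u v ≡ c u v b) → Conclusion
          case-III tuv∈αγ with unique₄ k
          ... | (u≢v ∷ u≢a ∷ u≢b ∷ []) ∷ (v≢a ∷ v≢b ∷ []) ∷ (a≢b ∷ []) ∷ _ =
            α , used , inj₂ (inj₂ (three , e₀ , e₀≢α , meets))
            where
            three : numColours col ≡ 3
            three = ℕₚ.≤-antisym (colours-bound (palette [])
              (in-palette (αγ∈ uab∈αγ) (αγ∈ vab∈αγ) (αγ∈ ∘ tuv∈αγ))) 3≤colours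
            e₀ : Edge n
            e₀ = proj₁ (spanning u≢v u≢a v≢a)
            e₀-uva : Spans e₀ u v a
            e₀-uva = proj₂ (spanning u≢v u≢a v≢a)
            e₀≢α : col e₀ ≢ α
            e₀≢α eq = α≢β k (trans (sym eq) (sym (c-spans e₀-uva)))
            meets : ∀ f → f ≢ e₀ → col f ≢ α → interSize e₀ f ≡ 2
            meets f f≢e₀ f≢α with classify k f
            ... | inj₁ eq = contradiction eq f≢α
            ... | inj₂ (uva s) = contradiction (spans-unique s e₀-uva) f≢e₀
            ... | inj₂ (uvb s) = interSize-two e₀-uva s a≢b
            ... | inj₂ (uab s) = interSize-two (swap₂₃ e₀-uva) s v≢b
            ... | inj₂ (vab s) = interSize-two (swap₂₃ (swap₁₂ e₀-uva)) s u≢b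
            ... | inj₂ (xuv (_ ∷ _ ∷ xa ∷ _) s) = interSize-two e₀-uva (swap₂₃ (swap₁₂ s)) (≢-sym xa)
            ... | inj₂ (xua (_ ∷ xv ∷ _) s) =
              interSize-two (swap₂₃ e₀-uva) (swap₂₃ (swap₁₂ s)) (≢-sym xv)
            ... | inj₂ (xva (xu ∷ _) s) =
              interSize-two (swap₂₃ (swap₁₂ e₀-uva)) (swap₂₃ (swap₁₂ s)) (≢-sym xu)
            ... | inj₂ (xub o s) = contradiction (is-α s (ub o)) f≢α
            ... | inj₂ (xvb o s) = contradiction (is-α s (vb o)) f≢α

          from-two-fans : Conclusion
          from-two-fans with any? (λ t → out? t ×-dec ¬? (αγ? (c t u v)))
          ... | yes (_ , os , suv∉αγ) = from-fourth-colour os suv∉αγ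
          ... | no none = case-III λ {t} ot →
            decidable-stable (αγ? (c t u v)) λ tuv∉αγ → none (t , ot , tuv∉αγ)

      one-sided : ∀ {u v a b α} (k : Kernel u v a b α) →
        (∀ {x} → Outside u v a b x → c x v a ≡ α) → (∀ {x} → Outside u v a b x → c x v b ≡ α) → Conclusion
      one-sided {u} {v} {a} {b} k va vb
        with FromKernel.constant k (λ x → c x u a) | FromKernel.constant k (λ x → c x u b)
      ... | inj₂ (_ , ox , xua≢α) | _ = FromKernel.OneSided.from-xua k va vb ox xua≢α
      ... | inj₁ _ | inj₂ (_ , ox , xub≢α) =
        FromKernel.OneSided.from-xua (kernel-ab k) (vb ∘ outside-ab) (va ∘ outside-ab) (outside-ab ox) xub≢α
      ... | inj₁ ua | inj₁ ub = FromKernel.OneSided.from-uab-vab k va vb ua ub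

      -- If neither u nor v has both of its families constant, each has a deviating one. A deviation
      -- at u with b excludes one at v with a, and vice versa, so the two families share a or share
      -- b.
      conclude : ∀ {u v a b α} → Kernel u v a b α → Conclusion
      conclude {u} {v} {a} {b} k
        with FromKernel.constant k (λ x → c x v a) | FromKernel.constant k (λ x → c x v b)
           | FromKernel.constant k (λ x → c x u a) | FromKernel.constant k (λ x → c x u b)
      ... | inj₁ va | inj₁ vb | _ | _ = one-sided k va vb
      ... | _ | _ | inj₁ ua | inj₁ ub = one-sided (kernel-uv k) (ua ∘ outside-uv) (ub ∘ outside-uv)
      ... | inj₂ (_ , oy , yva≢α) | _ | inj₂ (_ , ox , xua≢α) | _ =
        FromKernel.TwoSided.from-two-fans k ox oy xua≢α yva≢α
      ... | _ | inj₂ (_ , oy , yvb≢α) | _ | inj₂ (_ , ox , xub≢α) =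
        FromKernel.TwoSided.from-two-fans (kernel-ab k) (outside-ab ox) (outside-ab oy) xub≢α yvb≢α
      ... | inj₂ (_ , oy , yva≢α) | _ | _ | inj₂ (_ , ox , xub≢α) =
        [ (λ p → contradiction p xub≢α) , (λ q → contradiction q yva≢α) ]′ (FromKernel.xub-yva k ox oy)
      ... | _ | inj₂ (_ , oy , yvb≢α) | inj₂ (_ , ox , xua≢α) | _ =
        [ (λ p → contradiction p yvb≢α) , (λ q → contradiction q xua≢α) ]′ (FromKernel.xvb-yua k oy ox)

theorem4p1 : (n : ℕ) → n ≥ 7 → (col : Colouring n) →
    ¬ RainbowLoosePath col → 3 ≤ numColours col →
    Σ ℕ λ α → Used col α × (CaseI col α ⊎ CaseII col ⊎ CaseIII col α)
theorem4p1 n n≥7 col no-path 3≤colours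
  with three-colours col 3≤colours
... | e₁ , e₂ , _ , ne₁₂ , _ with colours-differ⇒adjacent col e₁ e₂ ne₁₂
... | adjacent {u} {v} {a} {b} uvab! uva≢uvb
  with avoiding-two col 3≤colours (c col u v a) (c col u v b)
... | _ , e≢uva , e≢uvb = conclude 3≤colours (kernel (trichromatic⇒seed (record
  { uvab! = uvab! ; uva≢uvb = uva≢uvb ; e≢uva = e≢uva ; e≢uvb = e≢uvb })))
  where open NoRainbow col n≥7 (path-free col no-path)
        open Conclusions
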